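{- For every $\varepsilon\in(0,1)$ there is $N_0(\varepsilon)$ such that, for every integer $N>N_0(\varepsilon)$ and every real $y$ with $$(16\log N)^{1/\varepsilon}\le y\le N,$$ the following holds. Let $\mathcal P$ be a set of primes contained in $[y,2y]$ with $$|\mathcal P|\ge\frac{4(2y)^{1-\varepsilon}\log N}{\log y}.$$ For each $p\in\mathcal P$ let $I_p\subseteq\mathbb Z_p$ be an arbitrary prescribed interval with $|I_p|\le p^{1-\varepsilon}+1$. Let $A$ be the set of all integers $n\in\{0,1,\dots,N\}$ such that $n\bmod p\in I_p$ for every $p\in\mathcal P$. Then $A$ is an interval of length at most $p_0^{1-\varepsilon}+1$, where $p_0=\min\{p:p\in\mathcal P\}$.
   Context: $\mathbb Z_p=\mathbb Z/p\mathbb Z$. An interval in $\mathbb Z$ is a finite set of consecutive integers (possibly empty), and an interval in $\mathbb Z_p$ is a set of the form $\{\delta+j \bmod p: 0\le j\le r\}$. The length of an interval is its number of elements. -}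

module Defs where

open import Data.Empty using (⊥)
open import Data.Fin using (Fin; fromℕ<)
open import Data.Fin.Subset using (Subset) renaming (_∈_ to _∈ₛ_)
open import Data.Integer as ℤ using (ℤ; +_)
open import Data.Integer.DivMod using (_%ℕ_; n%ℕd<d)
open import Data.List using (List)
open import Data.List.Membership.Propositional using (_∈_)
open import Data.List.Relation.Unary.All using (All)
open import Data.Nat as ℕ using (ℕ; zero; suc; NonZero)
open import Data.Product using (Σ-syntax; ∃-syntax; _×_)
open import Data.Rational as ℚ using (ℚ; 0ℚ; 1ℚ)
open import Data.Sum using (_⊎_)
open import Function.Bundles using (_⇔_)
open import Relation.Binary.PropositionalEquality using (_≡_)

------------------------------------------------------------------------
-- Real numbers

-- A real number x is given by its Dedekind cut: lower q means q < x and
-- upper q means x < q.  The operations below are defined on arbitrary pairs of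
-- predicates, so that they carry no side conditions; variables that range over
-- the reals are constrained by IsReal.
record Cut : Set₁ where
  field
    lower upper : ℚ → Set

open Cut public

record IsReal (x : Cut) : Set where
  field
    lower-inhabited : ∃[ q ] lower x q
    upper-inhabited : ∃[ q ] upper x q
    lower-closed    : ∀ {q r} → q ℚ.< r → lower x r → lower x q
    upper-closed    : ∀ {q r} → q ℚ.< r → upper x q → upper x r
    lower-open      : ∀ {q} → lower x q → ∃[ r ] (q ℚ.< r × lower x r)
    upper-open      : ∀ {r} → upper x r → ∃[ q ] (q ℚ.< r × upper x q)
    disjoint        : ∀ {q} → lower x q → upper x q → ⊥
    located         : ∀ {q r} → q ℚ.< r → lower x q ⊎ upper x r

infix  4 _<_ _≤_
infixl 6 _+_ _-_
infixl 7 _*_ _/_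
infixr 8 _^_
infix  9 _⁻¹

_<_ : Cut → Cut → Set
x < y = ∃[ q ] (upper x q × lower y q)

_≤_ : Cut → Cut → Set
x ≤ y = ∀ q → lower x q → lower y q

rat : ℚ → Cut
rat a = record { lower = ℚ._< a ; upper = a ℚ.<_ }

nat : ℕ → Cut
nat n = rat (+ n ℚ./ 1)

_+_ : Cut → Cut → Cut
x + y = record
  { lower = λ q → ∃[ a ] ∃[ b ] (lower x a × lower y b × q ≡ a ℚ.+ b)
  ; upper = λ q → ∃[ a ] ∃[ b ] (upper x a × upper y b × q ≡ a ℚ.+ b)
  }

-_ : Cut → Cut
- x = record
  { lower = λ q → upper x (ℚ.- q)
  ; upper = λ q → lower x (ℚ.- q)
  }

_-_ : Cut → Cut → Cut
x - y = x + (- y)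

-- Interval multiplication: for a < x < b and c < y < d, the product xy lies
-- strictly between the least and the greatest of ac, ad, bc, bd.
_*_ : Cut → Cut → Cut
x * y = record
  { lower = λ q → ∃[ a ] ∃[ b ] ∃[ c ] ∃[ d ]
      (lower x a × upper x b × lower y c × upper y d ×
       q ℚ.< a ℚ.* c × q ℚ.< a ℚ.* d × q ℚ.< b ℚ.* c × q ℚ.< b ℚ.* d)
  ; upper = λ q → ∃[ a ] ∃[ b ] ∃[ c ] ∃[ d ]
      (lower x a × upper x b × lower y c × upper y d ×
       a ℚ.* c ℚ.< q × a ℚ.* d ℚ.< q × b ℚ.* c ℚ.< q × b ℚ.* d ℚ.< q)
  }

-- The reciprocal of a positive real.
_⁻¹ : Cut → Cut
x ⁻¹ = record
  { lower = λ q → ∃[ r ] (0ℚ ℚ.< r × upper x r × q ℚ.* r ℚ.< 1ℚ)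
  ; upper = λ q → ∃[ r ] (0ℚ ℚ.< r × lower x r × 1ℚ ℚ.< q ℚ.* r)
  }

-- Used only for y > 0.
_/_ : Cut → Cut → Cut
x / y = x * y ⁻¹

-- The limit of a convergent sequence of rationals.
limit : (ℕ → ℚ) → Cut
limit s = record
  { lower = λ q → ∃[ r ] (q ℚ.< r × ∃[ m ] (∀ n → m ℕ.≤ n → r ℚ.≤ s n))
  ; upper = λ q → ∃[ r ] (r ℚ.< q × ∃[ m ] (∀ n → m ℕ.≤ n → s n ℚ.≤ r))
  }

-- t ^ i / i !
expTerm : ℚ → ℕ → ℚ
expTerm t zero    = 1ℚ
expTerm t (suc i) = expTerm t i ℚ.* (t ℚ.* (+ 1 ℚ./ suc i))

-- The sum of the first n terms of the exponential series.
expSum : ℚ → ℕ → ℚ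
expSum t zero    = 0ℚ
expSum t (suc n) = expSum t n ℚ.+ expTerm t n

expℚ : ℚ → Cut
expℚ t = limit (expSum t)

-- The extension of expℚ to the reals, which is determined by monotonicity and
-- continuity.
exp : Cut → Cut
exp x = record
  { lower = λ q → ∃[ t ] (lower x t × lower (expℚ t) q)
  ; upper = λ q → ∃[ t ] (upper x t × upper (expℚ t) q)
  }

-- The natural logarithm of a positive real, as the inverse of exp:
-- t < log x iff exp t < x, and log x < t iff x < exp t.
log : Cut → Cut
log x = record
  { lower = λ t → expℚ t < x
  ; upper = λ t → x < expℚ t
  }

-- Real powers of a positive real.
_^_ : Cut → Cut → Cut
x ^ a = exp (a * log x)

------------------------------------------------------------------------
-- Intervals

-- S is an interval with ℓ elements; it is empty for ℓ = 0.
IsInterval : (ℤ → Set) → ℕ → Set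
IsInterval S ℓ = Σ[ a ∈ ℤ ] (∀ n → S n ⇔ (a ℤ.≤ n × n ℤ.< a ℤ.+ + ℓ))

-- The class of n in ℤ/pℤ, with Fin p as the set of classes.
residue : ℤ → (p : ℕ) .{{_ : NonZero p}} → Fin p
residue n p = fromℕ< (n%ℕd<d n p)

-- { δ + j mod p : 0 ≤ j ≤ r }, which is empty for negative r.
IsIntervalMod : (p : ℕ) .{{_ : NonZero p}} → Subset p → Set
IsIntervalMod p I =
  Σ[ δ ∈ ℤ ] Σ[ r ∈ ℤ ] (∀ x → (x ∈ₛ I) ⇔
    (∃[ j ] (+ 0 ℤ.≤ j × j ℤ.≤ r × x ≡ residue (δ ℤ.+ j) p)))

Sieved : ℕ → List ℕ → ((p : ℕ) → Subset p) → ℤ → Set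
Sieved N P I n =
  + 0 ℤ.≤ n × n ℤ.≤ + N ×
  (∀ p .{{_ : NonZero p}} → p ∈ P → residue n p ∈ₛ I p)

IsMinimum : ℕ → List ℕ → Set
IsMinimum p₀ P = p₀ ∈ P × All (p₀ ℕ.≤_) P

module Submission where

-- Let D + 1 ≥ 2 bound all cardinalities |I p|, optimally.  If a < b both lie in the
-- sieved set and b - a > D, every p in P divides one of the 2D + 1 positive
-- numbers b - a - d with |d| ≤ D, hence p₀ ^ |P| ≤ (2N) ^ (2D + 1); since D is at
-- most about (2y) ^ (1 - ε), this contradicts the lower bound on |P|.  So b - a ≤ D,
-- which is less than p / 4 because y ^ ε is large, and then the residues of a and b
-- sit in I p at distance exactly b - a: everything between them survives the
-- sieve, and b - a < |I p₀|.
--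
-- The logarithmic inequalities are transferred to the integers through
-- the partial sums E n of the exponential series, by means of
-- E n (s + t) ≤ E n s * E n t and E m s * E n t ≤ E (m + n) (s + t) for s, t ≥ 0.

-- The contradiction has little room. Since D ≥ 1, the exponent 2D + 1 is at most 3D, while the
-- hypothesis on |P| supplies the constant 4; the factor 2 in 2N must fit in between. Both sides are
-- therefore compared with the exponent 7/2, whose denominator is cleared by squaring: p₀ ^ (2|P|)
-- against N ^ (7D). The room between 7 and 8 pays for the Dedekind cuts: they are open, so each
-- passage through a cut loses strictly, and each loss is charged to a factor `θ` slightly below 1.
-- Reals can be neither compared nor rounded effectively, so D is read off from the cardinalities
-- themselves and not from the real bound (2y) ^ (1 - ε). A rational exponent may be negative, where
-- the partial sums of the series are not monotone; the one fact needed there is that exp does not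
-- exceed 1, and it takes a separate argument.

-- Rational arithmetic

module RationalArithmetic where

  open import Algebra.Bundles using (CommutativeRing)
  open import Data.Integer as ℤ using (+_)
  import Data.Integer.Properties as ℤ
  open import Data.Nat as ℕ using (ℕ; zero; suc)
  import Data.Nat.Coprimality as ℕ
  import Data.Nat.Properties as ℕ
  open import Data.Product using (∃-syntax; _,_)
  open import Data.Rational
  open import Data.Rational.Properties
  open import Relation.Binary.PropositionalEquality
  open import Relation.Nullary.Decidable using (dec⇒maybe; from-yes)
  open import Tactic.RingSolver.Core.AlmostCommutativeRing
    using (AlmostCommutativeRing; fromCommutativeRing)
  open import Algebra.Properties.CommutativeSemiring.Exp
    (CommutativeRing.commutativeSemiring +-*-commutativeRing) public
    using (_^_; ^-distrib-*)

  ring : AlmostCommutativeRing _ _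
  ring = fromCommutativeRing +-*-commutativeRing λ x → dec⇒maybe (0ℚ ≟ x)

  *-nonneg : ∀ {a b} → 0ℚ ≤ a → 0ℚ ≤ b → 0ℚ ≤ a * b
  *-nonneg {a} {b} 0≤a 0≤b = nonNegative⁻¹ (a * b)
    {{nonNeg*nonNeg⇒nonNeg a {{nonNegative 0≤a}} b {{nonNegative 0≤b}}}}

  *-positive : ∀ {a b} → 0ℚ < a → 0ℚ < b → 0ℚ < a * b
  *-positive {a} {b} 0<a 0<b = positive⁻¹ (a * b)
    {{pos*pos⇒pos a {{positive 0<a}} b {{positive 0<b}}}}

  *-monoʳ : ∀ {a b c} → 0ℚ ≤ a → b ≤ c → a * b ≤ a * c
  *-monoʳ {a} 0≤a = *-monoˡ-≤-nonNeg a {{nonNegative 0≤a}}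

  *-monoˡ : ∀ {a b c} → 0ℚ ≤ c → a ≤ b → a * c ≤ b * c
  *-monoˡ {c = c} 0≤c = *-monoʳ-≤-nonNeg c {{nonNegative 0≤c}}

  *-mono : ∀ {a b c d} → 0ℚ ≤ a → a ≤ b → 0ℚ ≤ c → c ≤ d → a * c ≤ b * d
  *-mono 0≤a a≤b 0≤c c≤d = ≤-trans (*-monoˡ 0≤c a≤b) (*-monoʳ (≤-trans 0≤a a≤b) c≤d)

  *-monoʳ-< : ∀ {a b c} → 0ℚ < a → b < c → a * b < a * c
  *-monoʳ-< {a} 0<a = *-monoʳ-<-pos a {{positive 0<a}}

  *-monoˡ-< : ∀ {a b c} → 0ℚ < c → a < b → a * c < b * c
  *-monoˡ-< {c = c} 0<c = *-monoˡ-<-pos c {{positive 0<c}}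

  0≤1 : 0ℚ ≤ 1ℚ
  0≤1 = from-yes (0ℚ ≤? 1ℚ)

  ≤+nonneg : ∀ {a b} → 0ℚ ≤ b → a ≤ a + b
  ≤+nonneg {a} {b} 0≤b = subst (_≤ a + b) (+-identityʳ a) (+-monoʳ-≤ a 0≤b)

  +-nonneg : ∀ {a b} → 0ℚ ≤ a → 0ℚ ≤ b → 0ℚ ≤ a + b
  +-nonneg 0≤a 0≤b = ≤-trans 0≤a (≤+nonneg 0≤b)

  ι : ℕ → ℚ
  ι n = + n / 1

  private
    -- `+ n / 1` does not reduce for a variable `n`, because it divides by a gcd. The explicit
    -- fraction lets sums, products and comparisons compute.
    ι-reduced : ∀ n → ι n ≡ mkℚ (+ n) 0 (ℕ.sym (ℕ.1-coprimeTo n))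
    ι-reduced n = fromℚᵘ-toℚᵘ (mkℚ (+ n) 0 (ℕ.sym (ℕ.1-coprimeTo n)))

  ι-homo-+ : ∀ m n → ι (m ℕ.+ n) ≡ ι m + ι n
  ι-homo-+ m n rewrite ι-reduced m | ι-reduced n =
    cong (_/ 1) (sym (cong₂ ℤ._+_ (ℤ.*-identityʳ (+ m)) (ℤ.*-identityʳ (+ n))))

  ι-homo-* : ∀ m n → ι (m ℕ.* n) ≡ ι m * ι n
  ι-homo-* m n rewrite ι-reduced m | ι-reduced n = cong (_/ 1) (ℤ.pos-* m n)

  ι-suc : ∀ n → ι (suc n) ≡ 1ℚ + ι n
  ι-suc = ι-homo-+ 1

  ι-mono-≤ : ∀ {m n} → m ℕ.≤ n → ι m ≤ ι n
  ι-mono-≤ {m} {n} m≤n rewrite ι-reduced m | ι-reduced n =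
    *≤* (subst₂ ℤ._≤_ (sym (ℤ.*-identityʳ (+ m))) (sym (ℤ.*-identityʳ (+ n))) (ℤ.+≤+ m≤n))

  ι-mono-< : ∀ {m n} → m ℕ.< n → ι m < ι n
  ι-mono-< {m} {n} m<n rewrite ι-reduced m | ι-reduced n =
    *<* (subst₂ ℤ._<_ (sym (ℤ.*-identityʳ (+ m))) (sym (ℤ.*-identityʳ (+ n))) (ℤ.+<+ m<n))

  ι-cancel-≤ : ∀ {m n} → ι m ≤ ι n → m ℕ.≤ n
  ι-cancel-≤ {m} {n} ιm≤ιn = ℕ.≮⇒≥ λ n<m → <-irrefl refl (<-≤-trans (ι-mono-< {n} {m} n<m) ιm≤ιn)

  ι-cancel-< : ∀ {m n} → ι m < ι n → m ℕ.< n
  ι-cancel-< {m} {n} ιm<ιn = ℕ.≰⇒> λ n≤m → <-irrefl refl (<-≤-trans ιm<ιn (ι-mono-≤ {n} {m} n≤m))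

  0≤ι : ∀ n → 0ℚ ≤ ι n
  0≤ι n = ι-mono-≤ {0} {n} ℕ.z≤n

  ι-homo-^ : ∀ m n → ι (m ℕ.^ n) ≡ ι m ^ n
  ι-homo-^ m zero    = refl
  ι-homo-^ m (suc n) = trans (ι-homo-* m (m ℕ.^ n)) (cong (ι m *_) (ι-homo-^ m n))

  inv : ∀ n .{{_ : ℕ.NonZero n}} → ℚ
  inv n = + 1 / n

  ι-inv : ∀ n .{{_ : ℕ.NonZero n}} → ι n * inv n ≡ 1ℚ
  ι-inv (suc n) = trans (cong₂ _*_ (ι-reduced (suc n)) inv-reduced) (*-inverseʳ p)
    where
    p = mkℚ (+ suc n) 0 (ℕ.sym (ℕ.1-coprimeTo (suc n)))
    inv-reduced : inv (suc n) ≡ mkℚ (+ 1) n _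
    inv-reduced = fromℚᵘ-toℚᵘ (mkℚ (+ 1) n (ℕ.sym (ℕ.sym (ℕ.1-coprimeTo (suc n)))))

  inv-positive : ∀ n .{{_ : ℕ.NonZero n}} → 0ℚ < inv n
  inv-positive n = positive⁻¹ (inv n) {{normalize-pos 1 n}}

  -- The absolute value of the numerator suffices, the denominator being at least 1.
  ≤ι : ∀ q → ∃[ n ] q ≤ ι n
  ≤ι q@(mkℚ p d _) = ℤ.∣ p ∣ , subst (q ≤_) (sym (ι-reduced ℤ.∣ p ∣)) (*≤* (begin
    p ℤ.* + 1                   ≡⟨ ℤ.*-identityʳ p ⟩
    p                           ≤⟨ i≤∣i∣ p ⟩
    + ℤ.∣ p ∣                   ≤⟨ ℤ.+≤+ (ℕ.m≤m*n ℤ.∣ p ∣ (suc d)) ⟩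
    + (ℤ.∣ p ∣ ℕ.* suc d)       ≡⟨ ℤ.pos-* ℤ.∣ p ∣ (suc d) ⟩
    + ℤ.∣ p ∣ ℤ.* + suc d       ∎))
    where
    open ℤ.≤-Reasoning
    i≤∣i∣ : ∀ i → i ℤ.≤ + ℤ.∣ i ∣
    i≤∣i∣ (+ n)        = ℤ.≤-refl
    i≤∣i∣ ℤ.-[1+ n ] = ℤ.-≤+

  ^-nonneg : ∀ {a} n → 0ℚ ≤ a → 0ℚ ≤ a ^ n
  ^-nonneg zero    0≤a = 0≤1
  ^-nonneg (suc n) 0≤a = *-nonneg 0≤a (^-nonneg n 0≤a)

  ^-mono : ∀ {a b} n → 0ℚ ≤ a → a ≤ b → a ^ n ≤ b ^ n
  ^-mono zero    0≤a a≤b = ≤-refl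
  ^-mono (suc n) 0≤a a≤b = *-mono 0≤a a≤b (^-nonneg n 0≤a) (^-mono n 0≤a a≤b)

  ^-mono-< : ∀ {a b} n → 0ℚ ≤ a → a < b → a ^ suc n < b ^ suc n
  ^-mono-< {a} {b} zero    0≤a a<b = subst₂ _<_ (sym (*-identityʳ a)) (sym (*-identityʳ b)) a<b
  ^-mono-< {a} {b} (suc n) 0≤a a<b =
    ≤-<-trans (*-monoˡ (^-nonneg (suc n) 0≤a) (<⇒≤ a<b))
              (*-monoʳ-< (≤-<-trans 0≤a a<b) (^-mono-< n 0≤a a<b))

  ^-cancel-≤ : ∀ {a b} n .{{_ : ℕ.NonZero n}} → 0ℚ ≤ b → a ^ n ≤ b ^ n → a ≤ b
  ^-cancel-≤ (suc n) 0≤b aⁿ≤bⁿ = ≮⇒≥ λ b<a → <-irrefl refl (<-≤-trans (^-mono-< n 0≤b b<a) aⁿ≤bⁿ)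

-- The exponential series: finite sums and Cauchy products

module ExponentialSeries where

  open import Defs using (expTerm; expSum)
  open import Data.Nat as ℕ using (ℕ; zero; suc)
  import Data.Nat.Properties as ℕ
  open import Data.Product using (_×_; _,_; proj₁; proj₂)
  open import Data.Rational
  open import Data.Rational.Properties
  open import Function using (_∘_)
  open import Relation.Binary.PropositionalEquality
  open import Relation.Nullary using (¬_)
  open import Relation.Nullary.Decidable using (from-yes)
  open import Tactic.RingSolver using (solve-∀)
  open RationalArithmetic

  ∑ : (ℕ → ℚ) → ℕ → ℚ
  ∑ f zero    = 0ℚ
  ∑ f (suc n) = ∑ f n + f n

  ∑-suc : ∀ f n → ∑ f (suc n) ≡ f 0 + ∑ (f ∘ suc) n
  ∑-suc f zero    = +-comm 0ℚ (f 0)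
  ∑-suc f (suc n) = trans (cong (_+ f (suc n)) (∑-suc f n)) (+-assoc (f 0) _ _)

  ∑-shift : ∀ f m n → ∑ f (m ℕ.+ n) ≡ ∑ f m + ∑ (f ∘ (m ℕ.+_)) n
  ∑-shift f m zero    rewrite ℕ.+-identityʳ m = sym (+-identityʳ _)
  ∑-shift f m (suc n) rewrite ℕ.+-suc m n =
    trans (cong (_+ f (m ℕ.+ n)) (∑-shift f m n)) (+-assoc (∑ f m) _ _)

  ∑-nonneg : ∀ {f} → (∀ i → 0ℚ ≤ f i) → ∀ n → 0ℚ ≤ ∑ f n
  ∑-nonneg 0≤f zero    = ≤-refl
  ∑-nonneg 0≤f (suc n) = +-nonneg (∑-nonneg 0≤f n) (0≤f n)

  ∑-mono : ∀ {f g} → (∀ i → f i ≤ g i) → ∀ n → ∑ f n ≤ ∑ g n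
  ∑-mono f≤g zero    = ≤-refl
  ∑-mono f≤g (suc n) = +-mono-≤ (∑-mono f≤g n) (f≤g n)

  ∑-monoʳ : ∀ {f} → (∀ i → 0ℚ ≤ f i) → ∀ {m n} → m ℕ.≤ n → ∑ f m ≤ ∑ f n
  ∑-monoʳ {f} 0≤f {m} {n} m≤n =
    subst (λ k → ∑ f m ≤ ∑ f k) (ℕ.m+[n∸m]≡n m≤n)
      (subst (∑ f m ≤_) (sym (∑-shift f m (n ℕ.∸ m)))
        (≤+nonneg (∑-nonneg (λ i → 0≤f (m ℕ.+ i)) (n ℕ.∸ m))))

  -- The coefficient of the Cauchy product, that is the sum of f i * g (n - i) over i ≤ n. Peeling
  -- off `f 0` and shifting `f` avoids subtraction of indices.
  conv : (ℕ → ℚ) → (ℕ → ℚ) → ℕ → ℚ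
  conv f g zero    = f 0 * g 0
  conv f g (suc n) = f 0 * g (suc n) + conv (f ∘ suc) g n

  conv-+ : ∀ {h f f′} g → (∀ i → h i ≡ f i + f′ i) →
           ∀ n → conv h g n ≡ conv f g n + conv f′ g n
  conv-+ {h} {f} {f′} g h≡ zero = trans (cong (_* g 0) (h≡ 0)) (*-distribʳ-+ (g 0) (f 0) (f′ 0))
  conv-+ {h} {f} {f′} g h≡ (suc n) = trans
    (cong₂ (λ x y → x * g (suc n) + y) (h≡ 0) (conv-+ g (h≡ ∘ suc) n))
    (lem (f 0) (f′ 0) (g (suc n)) _ _)
    where
    lem : ∀ a b c x y → (a + b) * c + (x + y) ≡ (a * c + x) + (b * c + y)
    lem = solve-∀ ring

  conv-*ˡ : ∀ {h f} c g → (∀ i → h i ≡ c * f i) → ∀ n → conv h g n ≡ c * conv f g n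
  conv-*ˡ {h} {f} c g h≡ zero = trans (cong (_* g 0) (h≡ 0)) (*-assoc c (f 0) (g 0))
  conv-*ˡ {h} {f} c g h≡ (suc n) = trans
    (cong₂ (λ x y → x * g (suc n) + y) (h≡ 0) (conv-*ˡ c g (h≡ ∘ suc) n))
    (lem c (f 0) (g (suc n)) _)
    where
    lem : ∀ c a b x → c * a * b + c * x ≡ c * (a * b + x)
    lem = solve-∀ ring

  conv-*ʳ : ∀ {h g} c f → (∀ i → h i ≡ c * g i) → ∀ n → conv f h n ≡ c * conv f g n
  conv-*ʳ {h} {g} c f h≡ zero = trans (cong (f 0 *_) (h≡ 0)) (lem c (f 0) (g 0))
    where
    lem : ∀ c a b → a * (c * b) ≡ c * (a * b)
    lem = solve-∀ ring
  conv-*ʳ {h} {g} c f h≡ (suc n) = trans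
    (cong₂ (λ x y → f 0 * x + y) (h≡ (suc n)) (conv-*ʳ c (f ∘ suc) h≡ n))
    (lem c (f 0) (g (suc n)) _)
    where
    lem : ∀ c a b x → a * (c * b) + c * x ≡ c * (a * b + x)
    lem = solve-∀ ring

  -- Coefficients of the formal derivative of the power series with coefficients `f`.
  deriv : (ℕ → ℚ) → ℕ → ℚ
  deriv f i = ι (suc i) * f (suc i)

  -- The product rule for formal power series. With F = f 0 + X G the induction passes from F to G,
  -- and `shift` is the identity F' = G + X G'.
  leibniz : ∀ f g n →
    ι (suc n) * conv f g (suc n) ≡ conv (deriv f) g n + conv f (deriv g) n
  leibniz f g zero = lem (f 0) (f 1) (g 0) (g 1) 1ℚ
    where
    lem : ∀ a b c d e → e * (a * d + b * c) ≡ e * b * c + a * (e * d)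
    lem = solve-∀ ring
  leibniz f g (suc n) = begin
    ι (2 ℕ.+ n) * (f 0 * g (2 ℕ.+ n) + conv Sf g (suc n))
      ≡⟨ *-distribˡ-+ (ι (2 ℕ.+ n)) _ _ ⟩
    ι (2 ℕ.+ n) * (f 0 * g (2 ℕ.+ n)) + ι (2 ℕ.+ n) * conv Sf g (suc n)
      ≡⟨ cong (λ x → ι (2 ℕ.+ n) * (f 0 * g (2 ℕ.+ n)) + x * conv Sf g (suc n)) (ι-suc (suc n)) ⟩
    ι (2 ℕ.+ n) * (f 0 * g (2 ℕ.+ n)) + (1ℚ + ι (suc n)) * conv Sf g (suc n)
      ≡⟨ lem₁ (ι (2 ℕ.+ n)) (f 0) (g (2 ℕ.+ n)) (conv Sf g (suc n)) (ι (suc n)) ⟩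
    f 0 * deriv g (suc n) + (ι (suc n) * conv Sf g (suc n)) + conv Sf g (suc n)
      ≡⟨ cong (λ x → f 0 * deriv g (suc n) + x + conv Sf g (suc n)) (leibniz Sf g n) ⟩
    f 0 * deriv g (suc n) + (conv (deriv Sf) g n + conv Sf (deriv g) n)
      + (f 1 * g (suc n) + conv (Sf ∘ suc) g n)
      ≡⟨ lem₂ (f 0 * deriv g (suc n)) (conv (deriv Sf) g n) (conv Sf (deriv g) n) (f 1) (g (suc n)) _ ⟩
    (1ℚ * f 1 * g (suc n) + (conv (deriv Sf) g n + conv (Sf ∘ suc) g n))
      + (f 0 * deriv g (suc n) + conv Sf (deriv g) n)
      ≡⟨ cong (λ x → (1ℚ * f 1 * g (suc n) + x) + (f 0 * deriv g (suc n) + conv Sf (deriv g) n))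
           (conv-+ g shift n) ⟨
    conv (deriv f) g (suc n) + conv f (deriv g) (suc n) ∎
    where
    open ≡-Reasoning
    Sf = f ∘ suc
    shift : ∀ i → deriv f (suc i) ≡ deriv Sf i + f (2 ℕ.+ i)
    shift i = trans (cong (_* f (2 ℕ.+ i)) (ι-suc (suc i))) (lem (ι (suc i)) (f (2 ℕ.+ i)))
      where
      lem : ∀ a b → (1ℚ + a) * b ≡ a * b + b
      lem = solve-∀ ring
    lem₁ : ∀ a b c x y → a * (b * c) + (1ℚ + y) * x ≡ b * (a * c) + y * x + x
    lem₁ = solve-∀ ring
    lem₂ : ∀ a b c d e x → a + (b + c) + (d * e + x) ≡ (1ℚ * d * e + (b + x)) + (a + c)
    lem₂ = solve-∀ ring

  -- The sum of f i * g j over i + j < n.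
  triangle : (ℕ → ℚ) → (ℕ → ℚ) → ℕ → ℚ
  triangle f g = ∑ (conv f g)

  triangle-suc : ∀ f g n → triangle f g (suc n) ≡ f 0 * ∑ g (suc n) + triangle (f ∘ suc) g n
  triangle-suc f g zero    = lem (f 0) (g 0)
    where
    lem : ∀ a b → 0ℚ + a * b ≡ a * (0ℚ + b) + 0ℚ
    lem = solve-∀ ring
  triangle-suc f g (suc n) = trans
    (cong (_+ conv f g (suc n)) (triangle-suc f g n))
    (lem (f 0) (∑ g (suc n)) (g (suc n)) (triangle (f ∘ suc) g n) (conv (f ∘ suc) g n))
    where
    lem : ∀ a b c x y → a * b + x + (a * c + y) ≡ a * (b + c) + (x + y)
    lem = solve-∀ ring

  -- The triangle i + j < n lies in the square i, j < n, and all terms are nonnegative.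
  triangle≤square : ∀ {f g} → (∀ i → 0ℚ ≤ f i) → (∀ i → 0ℚ ≤ g i) →
                    ∀ n → triangle f g n ≤ ∑ f n * ∑ g n
  triangle≤square         0≤f 0≤g zero    = ≤-refl
  triangle≤square {f} {g} 0≤f 0≤g (suc n) = begin
    triangle f g (suc n)
      ≡⟨ triangle-suc f g n ⟩
    f 0 * ∑ g (suc n) + triangle (f ∘ suc) g n
      ≤⟨ +-monoʳ-≤ (f 0 * ∑ g (suc n)) (triangle≤square (0≤f ∘ suc) 0≤g n) ⟩
    f 0 * ∑ g (suc n) + ∑ (f ∘ suc) n * ∑ g n
      ≤⟨ +-monoʳ-≤ (f 0 * ∑ g (suc n))
           (*-monoʳ (∑-nonneg (0≤f ∘ suc) n) (∑-monoʳ 0≤g (ℕ.n≤1+n n))) ⟩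
    f 0 * ∑ g (suc n) + ∑ (f ∘ suc) n * ∑ g (suc n)
      ≡⟨ *-distribʳ-+ (∑ g (suc n)) (f 0) (∑ (f ∘ suc) n) ⟨
    (f 0 + ∑ (f ∘ suc) n) * ∑ g (suc n)
      ≡⟨ cong (_* ∑ g (suc n)) (∑-suc f n) ⟨
    ∑ f (suc n) * ∑ g (suc n) ∎
    where open ≤-Reasoning

  -- Likewise, i < m and j < n force i + j < m + n.
  rectangle≤triangle : ∀ {f g} → (∀ i → 0ℚ ≤ f i) → (∀ i → 0ℚ ≤ g i) →
                       ∀ m n → ∑ f m * ∑ g n ≤ triangle f g (m ℕ.+ n)
  rectangle≤triangle {f} {g} 0≤f 0≤g zero n =
    subst (_≤ triangle f g n) (sym (*-zeroˡ (∑ g n))) (∑-nonneg (0≤conv 0≤f 0≤g) n)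
    where
    0≤conv : ∀ {f g} → (∀ i → 0ℚ ≤ f i) → (∀ i → 0ℚ ≤ g i) → ∀ n → 0ℚ ≤ conv f g n
    0≤conv 0≤f 0≤g zero    = *-nonneg (0≤f 0) (0≤g 0)
    0≤conv 0≤f 0≤g (suc n) = +-nonneg (*-nonneg (0≤f 0) (0≤g (suc n))) (0≤conv (0≤f ∘ suc) 0≤g n)
  rectangle≤triangle {f} {g} 0≤f 0≤g (suc m) n = begin
    ∑ f (suc m) * ∑ g n
      ≡⟨ cong (_* ∑ g n) (∑-suc f m) ⟩
    (f 0 + ∑ (f ∘ suc) m) * ∑ g n
      ≡⟨ *-distribʳ-+ (∑ g n) (f 0) (∑ (f ∘ suc) m) ⟩
    f 0 * ∑ g n + ∑ (f ∘ suc) m * ∑ g n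
      ≤⟨ +-mono-≤ (*-monoʳ (0≤f 0) (∑-monoʳ 0≤g (ℕ.m≤n+m n (suc m))))
                  (rectangle≤triangle (0≤f ∘ suc) 0≤g m n) ⟩
    f 0 * ∑ g (suc m ℕ.+ n) + triangle (f ∘ suc) g (m ℕ.+ n)
      ≡⟨ triangle-suc f g (m ℕ.+ n) ⟨
    triangle f g (suc m ℕ.+ n) ∎
    where open ≤-Reasoning

  -- The functional equation on partial sums

  ι*expTerm : ∀ t i → deriv (expTerm t) i ≡ t * expTerm t i
  ι*expTerm t i = trans (lem (ι (suc i)) (expTerm t i) t (inv (suc i)))
    (trans (cong (_* (t * expTerm t i)) (ι-inv (suc i))) (*-identityˡ _))
    where
    lem : ∀ a b c d → a * (b * (c * d)) ≡ (a * d) * (c * b)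
    lem = solve-∀ ring

  -- Both sides satisfy (n + 1) c (n + 1) = (s + t) c n. For the convolution this is the product
  -- rule, as `deriv` multiplies each exponential series by its argument; binomial coefficients are
  -- avoided.
  conv-expTerm : ∀ s t n → conv (expTerm s) (expTerm t) n ≡ expTerm (s + t) n
  conv-expTerm s t zero    = *-identityˡ 1ℚ
  conv-expTerm s t (suc n) = begin
    c (suc n)
      ≡⟨ *-identityˡ (c (suc n)) ⟨
    1ℚ * c (suc n)
      ≡⟨ cong (_* c (suc n)) (ι-inv (suc n)) ⟨
    ι (suc n) * inv (suc n) * c (suc n)
      ≡⟨ lem₁ (ι (suc n)) (inv (suc n)) (c (suc n)) ⟩
    inv (suc n) * (ι (suc n) * c (suc n))
      ≡⟨ cong (inv (suc n) *_) (leibniz (expTerm s) (expTerm t) n) ⟩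
    inv (suc n) * (conv (deriv (expTerm s)) (expTerm t) n + conv (expTerm s) (deriv (expTerm t)) n)
      ≡⟨ cong (inv (suc n) *_) (cong₂ _+_ (conv-*ˡ s (expTerm t) (ι*expTerm s) n)
                                          (conv-*ʳ t (expTerm s) (ι*expTerm t) n)) ⟩
    inv (suc n) * (s * c n + t * c n)
      ≡⟨ lem₂ (inv (suc n)) s t (c n) ⟩
    c n * ((s + t) * inv (suc n))
      ≡⟨ cong (_* ((s + t) * inv (suc n))) (conv-expTerm s t n) ⟩
    expTerm (s + t) (suc n) ∎
    where
    open ≡-Reasoning
    c = conv (expTerm s) (expTerm t)
    lem₁ : ∀ a b x → a * b * x ≡ b * (a * x)
    lem₁ = solve-∀ ring
    lem₂ : ∀ a s t x → a * (s * x + t * x) ≡ x * ((s + t) * a)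
    lem₂ = solve-∀ ring

  expSum≡∑ : ∀ t n → expSum t n ≡ ∑ (expTerm t) n
  expSum≡∑ t zero    = refl
  expSum≡∑ t (suc n) = cong (_+ expTerm t n) (expSum≡∑ t n)

  ∑-cong : ∀ {f g} → (∀ i → f i ≡ g i) → ∀ n → ∑ f n ≡ ∑ g n
  ∑-cong f≡g zero    = refl
  ∑-cong f≡g (suc n) = cong₂ _+_ (∑-cong f≡g n) (f≡g n)

  expSum-+ : ∀ s t n → expSum (s + t) n ≡ triangle (expTerm s) (expTerm t) n
  expSum-+ s t n = trans (expSum≡∑ (s + t) n) (∑-cong (λ i → sym (conv-expTerm s t i)) n)

  expTerm-nonneg : ∀ {t} → 0ℚ ≤ t → ∀ i → 0ℚ ≤ expTerm t i
  expTerm-nonneg 0≤t zero    = 0≤1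
  expTerm-nonneg 0≤t (suc i) =
    *-nonneg (expTerm-nonneg 0≤t i) (*-nonneg 0≤t (<⇒≤ (inv-positive (suc i))))

  expTerm-mono : ∀ {s t} → 0ℚ ≤ s → s ≤ t → ∀ i → expTerm s i ≤ expTerm t i
  expTerm-mono 0≤s s≤t zero    = ≤-refl
  expTerm-mono 0≤s s≤t (suc i) =
    *-mono (expTerm-nonneg 0≤s i) (expTerm-mono 0≤s s≤t i)
      (*-nonneg 0≤s 0≤inv) (*-monoˡ 0≤inv s≤t)
    where 0≤inv = <⇒≤ (inv-positive (suc i))

  expSum-nonneg : ∀ {t} → 0ℚ ≤ t → ∀ n → 0ℚ ≤ expSum t n
  expSum-nonneg {t} 0≤t n = subst (0ℚ ≤_) (sym (expSum≡∑ t n)) (∑-nonneg (expTerm-nonneg 0≤t) n)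

  expSum-mono : ∀ {s t} → 0ℚ ≤ s → s ≤ t → ∀ n → expSum s n ≤ expSum t n
  expSum-mono {s} {t} 0≤s s≤t n =
    subst₂ _≤_ (sym (expSum≡∑ s n)) (sym (expSum≡∑ t n)) (∑-mono (expTerm-mono 0≤s s≤t) n)

  expSum-monoʳ : ∀ {t} → 0ℚ ≤ t → ∀ {m n} → m ℕ.≤ n → expSum t m ≤ expSum t n
  expSum-monoʳ {t} 0≤t {m} {n} m≤n =
    subst₂ _≤_ (sym (expSum≡∑ t m)) (sym (expSum≡∑ t n)) (∑-monoʳ (expTerm-nonneg 0≤t) m≤n)

  expSum-+-≤ : ∀ {s t} → 0ℚ ≤ s → 0ℚ ≤ t → ∀ n → expSum (s + t) n ≤ expSum s n * expSum t n
  expSum-+-≤ {s} {t} 0≤s 0≤t n = subst₂ _≤_ (sym (expSum-+ s t n))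
    (cong₂ _*_ (sym (expSum≡∑ s n)) (sym (expSum≡∑ t n)))
    (triangle≤square (expTerm-nonneg 0≤s) (expTerm-nonneg 0≤t) n)

  expSum-+-≥ : ∀ {s t} → 0ℚ ≤ s → 0ℚ ≤ t →
               ∀ m n → expSum s m * expSum t n ≤ expSum (s + t) (m ℕ.+ n)
  expSum-+-≥ {s} {t} 0≤s 0≤t m n = subst₂ _≤_
    (cong₂ _*_ (sym (expSum≡∑ s m)) (sym (expSum≡∑ t n))) (sym (expSum-+ s t (m ℕ.+ n)))
    (rectangle≤triangle (expTerm-nonneg 0≤s) (expTerm-nonneg 0≤t) m n)

  1≤expSum-suc : ∀ {t} → 0ℚ ≤ t → ∀ n → 1ℚ ≤ expSum t (suc n)
  1≤expSum-suc 0≤t n = expSum-monoʳ 0≤t (ℕ.s≤s (ℕ.z≤n {n}))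

  expSum-0 : ∀ n → expSum 0ℚ (suc n) ≡ 1ℚ
  expSum-0 zero    = refl
  expSum-0 (suc n) = trans (cong₂ _+_ (expSum-0 n)
    (trans (cong (expTerm 0ℚ n *_) (*-zeroˡ (inv (suc n)))) (*-zeroʳ (expTerm 0ℚ n)))) (+-identityʳ 1ℚ)

  expSum-2 : ∀ t → expSum t 2 ≡ 1ℚ + t
  expSum-2 = lem
    where
    lem : ∀ t → 0ℚ + 1ℚ + 1ℚ * (t * 1ℚ) ≡ 1ℚ + t
    lem = solve-∀ ring

  ι-suc-* : ∀ k t → ι (suc k) * t ≡ t + ι k * t
  ι-suc-* k t = trans (cong (_* t) (ι-suc k)) (lem (ι k) t)
    where
    lem : ∀ a b → (1ℚ + a) * b ≡ b + a * b
    lem = solve-∀ ring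

  expSum-*-≤ : ∀ {t} → 0ℚ ≤ t → ∀ k n → expSum (ι k * t) n ≤ expSum t n ^ k
  expSum-*-≤ {t} 0≤t zero zero    = 0≤1
  expSum-*-≤ {t} 0≤t zero (suc n) =
    ≤-reflexive (trans (cong (λ x → expSum x (suc n)) (*-zeroˡ t)) (expSum-0 n))
  expSum-*-≤ {t} 0≤t (suc k) n = begin
    expSum (ι (suc k) * t) n         ≡⟨ cong (λ x → expSum x n) (ι-suc-* k t) ⟩
    expSum (t + ι k * t) n           ≤⟨ expSum-+-≤ 0≤t (*-nonneg (0≤ι k) 0≤t) n ⟩
    expSum t n * expSum (ι k * t) n  ≤⟨ *-monoʳ (expSum-nonneg 0≤t n) (expSum-*-≤ 0≤t k n) ⟩
    expSum t n ^ suc k               ∎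
    where open ≤-Reasoning

  -- The extra `suc` in the length makes the case `k = 0` true: the empty sum is 0, whereas one term
  -- gives 1.
  expSum-*-≥ : ∀ {t} → 0ℚ ≤ t → ∀ k n → expSum t n ^ k ≤ expSum (ι k * t) (suc (k ℕ.* n))
  expSum-*-≥ {t} 0≤t zero n = ≤-reflexive (sym (trans (cong (λ x → expSum x 1) (*-zeroˡ t)) (expSum-0 0)))
  expSum-*-≥ {t} 0≤t (suc k) n = begin
    expSum t n * expSum t n ^ k
      ≤⟨ *-monoʳ (expSum-nonneg 0≤t n) (expSum-*-≥ 0≤t k n) ⟩
    expSum t n * expSum (ι k * t) (suc (k ℕ.* n))
      ≤⟨ expSum-+-≥ 0≤t (*-nonneg (0≤ι k) 0≤t) n (suc (k ℕ.* n)) ⟩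
    expSum (t + ι k * t) (n ℕ.+ suc (k ℕ.* n))
      ≡⟨ cong₂ expSum (sym (ι-suc-* k t)) (ℕ.+-suc n (k ℕ.* n)) ⟩
    expSum (ι (suc k) * t) (suc (suc k ℕ.* n)) ∎
    where open ≤-Reasoning

  -- For n ≥ 1 the term 1 / n ! at least halves in each step, so that twice the
  -- first omitted term bounds the tail.
  expSum-1≤3 : ∀ n → expSum 1ℚ n ≤ ι 3
  expSum-1≤3 zero    = 0≤ι 3
  expSum-1≤3 (suc n) = ≤-trans (≤+nonneg (*-nonneg (0≤ι 2) (0≤e (suc n)))) (tail n)
    where
    open ≤-Reasoning
    e = expTerm 1ℚ
    0≤e = expTerm-nonneg 0≤1
    lem : ∀ x a → x + a * (1ℚ + 1ℚ) ≡ (x + a) + a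
    lem = solve-∀ ring
    2e≤e : ∀ n → ι 2 * e (2 ℕ.+ n) ≤ e (suc n)
    2e≤e n = begin
      ι 2 * e (2 ℕ.+ n)        ≤⟨ *-monoˡ (0≤e (2 ℕ.+ n)) (ι-mono-≤ {2} {2 ℕ.+ n} (ℕ.s≤s (ℕ.s≤s ℕ.z≤n))) ⟩
      ι (2 ℕ.+ n) * e (2 ℕ.+ n) ≡⟨ ι*expTerm 1ℚ (suc n) ⟩
      1ℚ * e (suc n)           ≡⟨ *-identityˡ (e (suc n)) ⟩
      e (suc n)                ∎
    tail : ∀ n → expSum 1ℚ (suc n) + ι 2 * e (suc n) ≤ ι 3
    tail zero    = from-yes (expSum 1ℚ 1 + ι 2 * e 1 ≤? ι 3)
    tail (suc n) = begin
      expSum 1ℚ (suc n) + e (suc n) + ι 2 * e (2 ℕ.+ n)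
        ≤⟨ +-monoʳ-≤ (expSum 1ℚ (suc n) + e (suc n)) (2e≤e n) ⟩
      expSum 1ℚ (suc n) + e (suc n) + e (suc n)
        ≡⟨ lem (expSum 1ℚ (suc n)) (e (suc n)) ⟨
      expSum 1ℚ (suc n) + e (suc n) * (1ℚ + 1ℚ)
        ≡⟨ cong (expSum 1ℚ (suc n) +_) (*-comm (e (suc n)) (ι 2)) ⟩
      expSum 1ℚ (suc n) + ι 2 * e (suc n)
        ≤⟨ tail n ⟩
      ι 3 ∎

  expSum-ι≤3^ : ∀ k n → expSum (ι k) n ≤ ι (3 ℕ.^ k)
  expSum-ι≤3^ k n = begin
    expSum (ι k) n        ≡⟨ cong (λ x → expSum x n) (*-identityʳ (ι k)) ⟨
    expSum (ι k * 1ℚ) n   ≤⟨ expSum-*-≤ 0≤1 k n ⟩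
    expSum 1ℚ n ^ k       ≤⟨ ^-mono k (expSum-nonneg 0≤1 n) (expSum-1≤3 n) ⟩
    ι 3 ^ k               ≡⟨ ι-homo-^ 3 k ⟨
    ι (3 ℕ.^ k)           ∎
    where open ≤-Reasoning

  -- Negative arguments

  ∣expTerm-neg∣ : ∀ {s} → 0ℚ ≤ s → ∀ n →
    - expTerm s n ≤ expTerm (- s) n × expTerm (- s) n ≤ expTerm s n
  ∣expTerm-neg∣ 0≤s zero = from-yes (- 1ℚ ≤? 1ℚ) , ≤-refl
  ∣expTerm-neg∣ {s} 0≤s (suc n) with ∣expTerm-neg∣ 0≤s n
  ... | l , u =
    subst (- expTerm s (suc n) ≤_) (lem₂ (expTerm (- s) n) s (inv (suc n))) (neg-antimono-≤ (*-monoˡ 0≤x u)) ,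
    subst₂ _≤_ (lem₂ (expTerm (- s) n) s (inv (suc n))) (lem₁ (expTerm s n) s (inv (suc n)))
      (neg-antimono-≤ (*-monoˡ 0≤x l))
    where
    0≤x : 0ℚ ≤ s * inv (suc n)
    0≤x = *-nonneg 0≤s (<⇒≤ (inv-positive (suc n)))
    lem₁ : ∀ a b c → - (- a * (b * c)) ≡ a * (b * c)
    lem₁ = solve-∀ ring
    lem₂ : ∀ a b c → - (a * (b * c)) ≡ a * (- b * c)
    lem₂ = solve-∀ ring

  -∑≤∑ : ∀ {f g} → (∀ i → - f i ≤ g i) → ∀ n → - ∑ f n ≤ ∑ g n
  -∑≤∑ -f≤g zero    = ≤-refl
  -∑≤∑ {f} {g} -f≤g (suc n) =
    subst (_≤ _) (sym (neg-distrib-+ (∑ f n) (f n))) (+-mono-≤ (-∑≤∑ -f≤g n) (-f≤g n))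

  -- Row i of the triangle is `f i` times a partial sum of `g` of length n + m - i. The rows with i
  -- < n have length at least m and are bounded below through `R`; the last m rows only through
  -- `- K`.
  triangle-lower : ∀ {f g} → (∀ i → 0ℚ ≤ f i) →
    ∀ {R K} m → (∀ n → m ℕ.≤ n → R ≤ ∑ g n) → (∀ n → - K ≤ ∑ g n) →
    ∀ n → R * ∑ f n - K * ∑ (f ∘ (n ℕ.+_)) m ≤ triangle f g (n ℕ.+ m)
  triangle-lower {f} {g} 0≤f {R} {K} m R≤ -K≤ zero =
    subst (_≤ triangle f g m) (lem R K (∑ f m)) (window f 0≤f m)
    where
    open ≤-Reasoning
    lem : ∀ r k x → - (k * x) ≡ r * 0ℚ - k * x
    lem = solve-∀ ring
    lem′ : ∀ k a x → - (k * (a + x)) ≡ a * - k + - (k * x)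
    lem′ = solve-∀ ring
    window : ∀ f → (∀ i → 0ℚ ≤ f i) → ∀ m → - (K * ∑ f m) ≤ triangle f g m
    window f 0≤f zero    = ≤-reflexive (cong -_ (*-zeroʳ K))
    window f 0≤f (suc m) = begin
      - (K * ∑ f (suc m))                    ≡⟨ cong (λ x → - (K * x)) (∑-suc f m) ⟩
      - (K * (f 0 + ∑ (f ∘ suc) m))          ≡⟨ lem′ K (f 0) _ ⟩
      f 0 * - K + - (K * ∑ (f ∘ suc) m)
        ≤⟨ +-mono-≤ (*-monoʳ (0≤f 0) (-K≤ (suc m))) (window (f ∘ suc) (0≤f ∘ suc) m) ⟩
      f 0 * ∑ g (suc m) + triangle (f ∘ suc) g m ≡⟨ triangle-suc f g m ⟨
      triangle f g (suc m)                   ∎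
  triangle-lower {f} {g} 0≤f {R} {K} m R≤ -K≤ (suc n) = begin
    R * ∑ f (suc n) - K * w
      ≡⟨ cong (λ x → R * x - K * w) (∑-suc f n) ⟩
    R * (f 0 + ∑ (f ∘ suc) n) - K * w
      ≡⟨ lem R K w (f 0) _ ⟩
    f 0 * R + (R * ∑ (f ∘ suc) n - K * w)
      ≤⟨ +-mono-≤ (*-monoʳ (0≤f 0) (R≤ (suc n ℕ.+ m) (ℕ.m≤n+m m (suc n))))
                  (triangle-lower (0≤f ∘ suc) m R≤ -K≤ n) ⟩
    f 0 * ∑ g (suc n ℕ.+ m) + triangle (f ∘ suc) g (n ℕ.+ m)
      ≡⟨ triangle-suc f g (n ℕ.+ m) ⟨
    triangle f g (suc n ℕ.+ m) ∎
    where
    open ≤-Reasoning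
    w = ∑ (f ∘ (suc n ℕ.+_)) m
    lem : ∀ r k w a x → r * (a + x) - k * w ≡ a * r + (r * x - k * w)
    lem = solve-∀ ring

  -- Consecutive windows of length m, each of sum at least `η`, would pile up past the bound: `L` of
  -- them contribute at least 1, so (J + 1) L of them exceed B - f 0. The negated form spares the
  -- search for a light window.
  small-window : ∀ {f B η} → (∀ n → ∑ f n ≤ B) → 0ℚ < η → ∀ m →
    ¬ (∀ n → η ≤ ∑ (f ∘ (suc n ℕ.+_)) m)
  small-window {f} {B} {η} ∑≤B 0<η m η≤ with ≤ι (B - f 0)
  ... | J , B≤J with ≤ι ((1/ η) {{>-nonZero 0<η}})
  ... | L , 1/η≤L = <-irrefl refl (begin-strict
    ι J                          <⟨ ι-mono-< {J} {suc J} ℕ.≤-refl ⟩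
    ι (suc J)                    ≡⟨ *-identityʳ (ι (suc J)) ⟨
    ι (suc J) * 1ℚ               ≤⟨ *-monoʳ (0≤ι (suc J)) 1≤Lη ⟩
    ι (suc J) * (ι L * η)        ≡⟨ *-assoc (ι (suc J)) (ι L) η ⟨
    ι (suc J) * ι L * η          ≡⟨ cong (_* η) (ι-homo-* (suc J) L) ⟨
    ι (suc J ℕ.* L) * η          ≤⟨ grow (suc J ℕ.* L) ⟩
    ∑ f (suc (suc J ℕ.* L ℕ.* m)) - f 0 ≤⟨ +-monoˡ-≤ (- f 0) (∑≤B (suc (suc J ℕ.* L ℕ.* m))) ⟩
    B - f 0                      ≤⟨ B≤J ⟩
    ι J                          ∎)
    where
    open ≤-Reasoning
    1≤Lη : 1ℚ ≤ ι L * η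
    1≤Lη = subst (_≤ ι L * η) (*-inverseˡ η {{>-nonZero 0<η}}) (*-monoˡ (<⇒≤ 0<η) 1/η≤L)
    lem : ∀ a b c → a - c + b ≡ a + b - c
    lem = solve-∀ ring
    lem₀ : ∀ a η → 0ℚ * η ≡ 0ℚ + a - a
    lem₀ = solve-∀ ring
    grow : ∀ j → ι j * η ≤ ∑ f (suc (j ℕ.* m)) - f 0
    grow zero    = ≤-reflexive (lem₀ (f 0) η)
    grow (suc j) = begin
      ι (suc j) * η                                             ≡⟨ ι-suc-* j η ⟩
      η + ι j * η                                               ≡⟨ +-comm η (ι j * η) ⟩
      ι j * η + η                                               ≤⟨ +-mono-≤ (grow j) (η≤ (j ℕ.* m)) ⟩
      ∑ f (suc (j ℕ.* m)) - f 0 + ∑ (f ∘ (suc (j ℕ.* m) ℕ.+_)) m ≡⟨ lem (∑ f (suc (j ℕ.* m))) _ (f 0) ⟩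
      ∑ f (suc (j ℕ.* m)) + ∑ (f ∘ (suc (j ℕ.* m) ℕ.+_)) m - f 0
        ≡⟨ cong (_- f 0) (∑-shift f (suc (j ℕ.* m)) m) ⟨
      ∑ f (suc (j ℕ.* m) ℕ.+ m) - f 0
        ≡⟨ cong (λ k → ∑ f (suc k) - f 0) (ℕ.+-comm (j ℕ.* m) m) ⟩
      ∑ f (suc (suc j ℕ.* m)) - f 0                             ∎

  -- The Cauchy product of the series for exp s and exp (- s) has all its
  -- triangular partial sums equal to 1.
  expSum-neg≤1 : ∀ {s} → 0ℚ ≤ s → ∀ {r} → 1ℚ < r → ∀ m → ¬ (∀ n → m ℕ.≤ n → r ≤ expSum (- s) n)
  expSum-neg≤1 {s} 0≤s {r} 1<r m r≤ = small-window {e} {K} ∑≤K 0<η m λ n → ≮⇒≥ λ w<η →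
    <-irrefl refl (begin-strict
      1ℚ                                  ≡⟨ lem₁ r 1ℚ ⟩
      r - (r - 1ℚ)                        <⟨ +-monoʳ-< r (neg-antimono-< (Kw< w<η)) ⟩
      r - K * ∑ (e ∘ (suc n ℕ.+_)) m      ≡⟨ cong (λ x → x - K * ∑ (e ∘ (suc n ℕ.+_)) m) (*-identityʳ r) ⟨
      r * 1ℚ - K * ∑ (e ∘ (suc n ℕ.+_)) m
        ≤⟨ +-monoˡ-≤ _ (*-monoʳ (≤-trans 0≤1 (<⇒≤ 1<r))
             (subst (1ℚ ≤_) (expSum≡∑ s (suc n)) (1≤expSum-suc 0≤s n))) ⟩
      r * ∑ e (suc n) - K * ∑ (e ∘ (suc n ℕ.+_)) m
        ≤⟨ triangle-lower (expTerm-nonneg 0≤s) m (λ n m≤n → subst (r ≤_) (expSum≡∑ (- s) n) (r≤ n m≤n))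
             (λ n → ≤-trans (neg-antimono-≤ (∑≤K n)) (-∑≤∑ (λ i → proj₁ (∣expTerm-neg∣ 0≤s i)) n))
             (suc n) ⟩
      triangle e (expTerm (- s)) (suc n ℕ.+ m)  ≡⟨ expSum-+ s (- s) (suc n ℕ.+ m) ⟨
      expSum (s - s) (suc n ℕ.+ m)        ≡⟨ cong (λ x → expSum x (suc n ℕ.+ m)) (+-inverseʳ s) ⟩
      expSum 0ℚ (suc n ℕ.+ m)             ≡⟨ expSum-0 (n ℕ.+ m) ⟩
      1ℚ                                  ∎)
    where
    open ≤-Reasoning
    e = expTerm s
    k = proj₁ (≤ι s)
    instance 3^k≢0 : ℕ.NonZero (3 ℕ.^ k)
             3^k≢0 = ℕ.m^n≢0 3 k
    K = ι (3 ℕ.^ k)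
    -- Chosen so that `K * η` is r - 1: in `triangle-lower` the last m rows then cost less than r -
    -- 1, while the others contribute at least r.
    η = (r - 1ℚ) * inv (3 ℕ.^ k)
    lem₁ : ∀ r a → a ≡ r - (r - a)
    lem₁ = solve-∀ ring
    ∑≤K : ∀ n → ∑ e n ≤ K
    ∑≤K n = subst (_≤ K) (expSum≡∑ s n)
      (≤-trans (expSum-mono 0≤s (proj₂ (≤ι s)) n) (expSum-ι≤3^ k n))
    0<r-1 : 0ℚ < r - 1ℚ
    0<r-1 = subst (_< r - 1ℚ) (+-inverseʳ 1ℚ) (+-monoˡ-< (- 1ℚ) 1<r)
    0<η : 0ℚ < η
    0<η = *-positive 0<r-1 (inv-positive (3 ℕ.^ k))
    lem₂ : ∀ a b c → a * (b * c) ≡ b * (a * c)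
    lem₂ = solve-∀ ring
    Kη : K * η ≡ r - 1ℚ
    Kη = trans (lem₂ K (r - 1ℚ) (inv (3 ℕ.^ k)))
      (trans (cong ((r - 1ℚ) *_) (ι-inv (3 ℕ.^ k))) (*-identityʳ (r - 1ℚ)))
    Kw< : ∀ {w} → w < η → K * w < r - 1ℚ
    Kw< {w} w<η = subst (K * w <_) Kη
      (*-monoʳ-< (ι-mono-< {0} {3 ℕ.^ k} (ℕ.>-nonZero⁻¹ (3 ℕ.^ k))) w<η)

-- Products of primes and windows of consecutive integers

module PrimesAndResidues where

  open import Defs using (residue; IsIntervalMod)
  open import Data.Empty using (⊥; ⊥-elim)
  open import Data.Fin as Fin using (Fin; toℕ)
  import Data.Fin.Properties as Fin
  open import Data.Fin.Subset using (Subset; ∣_∣; _-_) renaming (_∈_ to _∈ₛ_)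
  open import Data.Fin.Subset.Properties using (x∈p⇒∣p-x∣<∣p∣; x∈p∧x≢y⇒x∈p-y)
  open import Data.Integer as ℤ using (ℤ; +_)
  open import Data.Integer.DivMod using (_%ℕ_; _/ℕ_; n%ℕd<d; a≡a%ℕn+[a/ℕn]*n)
  import Data.Integer.Properties as ℤ
  open import Data.Integer.Divisibility.Signed using (divides; ∣⇒∣ᵤ)
    renaming (_∣_ to _∣ᶻ_; module _∣_ to _∣ᶻ_)
  import Data.Integer.Tactic.RingSolver as ℤ-Solver
  open import Data.List using ([]; _∷_; length)
  open import Data.List.Membership.Propositional using (_∈_)
  open import Data.List.Relation.Unary.All as All using (All; []; _∷_)
  import Data.List.Relation.Unary.All.Properties as All
  open import Data.List.Relation.Unary.Unique.Propositional using (Unique)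
  open import Data.List.Relation.Unary.AllPairs using ([]; _∷_)
  open import Data.Nat
  open import Data.Nat.Divisibility
  open import Data.Nat.ListAction using (product)
  open import Data.Nat.Primality using (Prime; euclidsLemma)
  open import Data.Nat.Primality.Factorisation using (factorisationHasAllPrimeFactors)
  open import Data.Nat.Properties
  open import Data.Nat.Tactic.RingSolver using (solve-∀)
  open import Data.Product using (∃-syntax; _×_; _,_; proj₁)
  open import Data.Sum using (_⊎_; inj₁; inj₂)
  open import Function using (_∘_)
  open import Function.Bundles using (Equivalence)
  open import Relation.Binary.PropositionalEquality
  open import Relation.Nullary using (¬_; Dec; yes; no)

  -- If `p` divided the product of the other primes, it would be one of them. Hence Euclid's lemma
  -- puts `p` into the cofactor `c`.
  product-primes-∣ : ∀ {m P} → Unique P → All Prime P → All (_∣ m) P → product P ∣ m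
  product-primes-∣ {m} [] [] [] = 1∣ m
  product-primes-∣ {m} {p ∷ P} (p∉P ∷ uP) (prime-p ∷ primes) (p∣m ∷ P∣m)
    with product-primes-∣ uP primes P∣m
  ... | divides c m≡cΠ with euclidsLemma c (product P) prime-p (subst (p ∣_) m≡cΠ p∣m)
  ...   | inj₁ p∣c = subst (p * product P ∣_) (sym m≡cΠ) (*-monoˡ-∣ (product P) p∣c)
  ...   | inj₂ p∣Π = ⊥-elim (All.All¬⇒¬Any p∉P (factorisationHasAllPrimeFactors prime-p p∣Π primes))

  ^-length≤product : ∀ {b P} → All (b ≤_) P → b ^ length P ≤ product P
  ^-length≤product []          = ≤-refl
  ^-length≤product (b≤p ∷ b≤P) = *-mono-≤ b≤p (^-length≤product b≤P)

  -- The rising factorial h (h + 1) ... (h + n - 1).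
  rising : ℕ → ℕ → ℕ
  rising h zero    = 1
  rising h (suc n) = rising h n * (h + n)

  ∣rising : ∀ h {j n} → j < n → h + j ∣ rising h n
  ∣rising h {j} {suc n} (s≤s j≤n) with m≤n⇒m<n∨m≡n j≤n
  ... | inj₁ j<n  = ∣m⇒∣m*n (h + n) (∣rising h j<n)
  ... | inj₂ refl = n∣m*n (rising h n)

  rising≤^ : ∀ {h B} n → (∀ {j} → j < n → h + j ≤ B) → rising h n ≤ B ^ n
  rising≤^ {h} {B} zero    _  = ≤-refl
  rising≤^ {h} {B} (suc n) ≤B =
    subst (rising h (suc n) ≤_) (*-comm (B ^ n) B)
      (*-mono-≤ (rising≤^ n (≤B ∘ m<n⇒m<1+n)) (≤B ≤-refl))

  rising≢0 : ∀ h .{{_ : NonZero h}} n → NonZero (rising h n)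
  rising≢0 h zero    = _
  rising≢0 h (suc n) = m*n≢0 (rising h n) (h + n) {{rising≢0 h n}} {{h+n≢0}}
    where
    h+n≢0 : NonZero (h + n)
    h+n≢0 = >-nonZero (≤-trans (>-nonZero⁻¹ h) (m≤m+n h n))

  -- Every prime divides some factor of `rising h n`, so the product of the distinct primes divides
  -- it; as h is positive the rising factorial is nonzero, and divisibility becomes an inequality.
  primes-dividing-window : ∀ {P} → Unique P → All Prime P → ∀ {b} → All (b ≤_) P →
    ∀ {h n B} .{{_ : NonZero h}} → (∀ {j} → j < n → h + j ≤ B) →
    (∀ {p} → p ∈ P → ∃[ j ] (j < n × p ∣ h + j)) → b ^ length P ≤ B ^ n
  primes-dividing-window {P} uP primes {b} b≤P {h} {n} {B} ≤B hit = begin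
    b ^ length P  ≤⟨ ^-length≤product b≤P ⟩
    product P     ≤⟨ ∣⇒≤ {{rising≢0 h n}} (product-primes-∣ uP primes (All.tabulate λ p∈P →
                       let j , j<n , p∣ = hit p∈P in ∣-trans p∣ (∣rising h j<n))) ⟩
    rising h n    ≤⟨ rising≤^ n ≤B ⟩
    B ^ n         ∎
    where open ≤-Reasoning

  ^-distribʳ-* : ∀ n a b → (a * b) ^ n ≡ a ^ n * b ^ n
  ^-distribʳ-* zero    a b = refl
  ^-distribʳ-* (suc n) a b = trans (cong (a * b *_) (^-distribʳ-* n a b)) ([m*n]*[o*p]≡[m*o]*[n*p] a b (a ^ n) (b ^ n))

  -- Squaring makes the exponent 7/2 integral. From D ≥ 1 follows 2 (2D + 1) ≤ 6D, and after 2N ≤ 4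
  -- (N - 1) the spare factor (N - 1) ^ D absorbs 3 * 4 ^ (6D), because 12288 = 3 * 4 ^ 6. The
  -- factor 3 stands for an upper bound of exp 1, and `pred N` leaves room for strictness; both are
  -- spent in `too-many`.
  power-comparison : ∀ {p k D N} .{{_ : NonZero D}} → 12288 < N →
    p ^ k ≤ (2 * N) ^ suc (2 * D) → p ^ (2 * k) * 3 ≤ pred N ^ (7 * D)
  power-comparison {p} {k} {D} {suc R} (s≤s 12288≤R) p^k≤ = begin
    p ^ (2 * k) * 3                            ≡⟨ cong (λ e → p ^ e * 3) (*-comm 2 k) ⟩
    p ^ (k * 2) * 3                            ≡⟨ cong (_* 3) (^-*-assoc p k 2) ⟨
    (p ^ k) ^ 2 * 3                            ≤⟨ *-monoˡ-≤ 3 (^-monoˡ-≤ 2 p^k≤) ⟩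
    ((2 * suc R) ^ suc (2 * D)) ^ 2 * 3        ≡⟨ cong (_* 3) (^-*-assoc (2 * suc R) (suc (2 * D)) 2) ⟩
    (2 * suc R) ^ (suc (2 * D) * 2) * 3        ≤⟨ *-monoˡ-≤ 3 (^-monoʳ-≤ (2 * suc R) exponent) ⟩
    (2 * suc R) ^ (6 * D) * 3                  ≤⟨ *-monoˡ-≤ 3 (^-monoˡ-≤ (6 * D) base) ⟩
    (4 * R) ^ (6 * D) * 3                      ≡⟨ cong (_* 3) (^-distribʳ-* (6 * D) 4 R) ⟩
    4 ^ (6 * D) * R ^ (6 * D) * 3              ≡⟨ rearrange (4 ^ (6 * D)) (R ^ (6 * D)) 3 ⟩
    3 * 4 ^ (6 * D) * R ^ (6 * D)              ≡⟨ cong (λ x → 3 * x * R ^ (6 * D)) (^-*-assoc 4 6 D) ⟨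
    3 * (4 ^ 6) ^ D * R ^ (6 * D)              ≤⟨ *-monoˡ-≤ (R ^ (6 * D)) (*-monoˡ-≤ ((4 ^ 6) ^ D) 3≤3^D) ⟩
    3 ^ D * (4 ^ 6) ^ D * R ^ (6 * D)          ≡⟨ cong (_* R ^ (6 * D)) (^-distribʳ-* D 3 (4 ^ 6)) ⟨
    (3 * 4 ^ 6) ^ D * R ^ (6 * D)              ≤⟨ *-monoˡ-≤ (R ^ (6 * D)) (^-monoˡ-≤ D 12288≤R) ⟩
    R ^ D * R ^ (6 * D)                        ≡⟨ ^-distribˡ-+-* R D (6 * D) ⟨
    R ^ (7 * D)                                ∎
    where
    open ≤-Reasoning
    1≤D = >-nonZero⁻¹ D
    1≤R : 1 ≤ R
    1≤R = ≤-trans (s≤s z≤n) 12288≤R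
    rearrange : ∀ a b c → a * b * c ≡ c * a * b
    rearrange = solve-∀
    exponent : suc (2 * D) * 2 ≤ 6 * D
    exponent = begin
      suc (2 * D) * 2   ≡⟨ lem D ⟩
      4 * D + 2 * 1     ≤⟨ +-monoʳ-≤ (4 * D) (*-monoʳ-≤ 2 1≤D) ⟩
      4 * D + 2 * D     ≡⟨ lem′ D ⟩
      6 * D             ∎
      where
      lem : ∀ D → suc (2 * D) * 2 ≡ 4 * D + 2 * 1
      lem = solve-∀
      lem′ : ∀ D → 4 * D + 2 * D ≡ 6 * D
      lem′ = solve-∀
    base : 2 * suc R ≤ 4 * R
    base = begin
      2 * suc R      ≡⟨ lem R ⟩
      2 * R + 2 * 1  ≤⟨ +-monoʳ-≤ (2 * R) (*-monoʳ-≤ 2 1≤R) ⟩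
      2 * R + 2 * R  ≡⟨ lem′ R ⟩
      4 * R          ∎
      where
      lem : ∀ R → 2 * suc R ≡ 2 * R + 2 * 1
      lem = solve-∀
      lem′ : ∀ R → 2 * R + 2 * R ≡ 4 * R
      lem′ = solve-∀
    3≤3^D : 3 ≤ 3 ^ D
    3≤3^D = ^-monoʳ-≤ 3 1≤D

  -- Residues and intervals modulo p

  private
    ∣+m-+n∣≤ : ∀ {m n k} → m ≤ k → n ≤ k → ℤ.∣ + m ℤ.- + n ∣ ≤ k
    ∣+m-+n∣≤ {m} {n} m≤k n≤k = subst (_≤ _) (cong ℤ.∣_∣ (sym (ℤ.[+m]-[+n]≡m⊖n m n)))
      (≤-trans (ℤ.∣m⊝n∣≤m⊔n m n) (⊔-lub m≤k n≤k))

    -- A multiple of `p` that is smaller than `p` in absolute value is zero.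
    close⇒≡ : ∀ {p m n} → m < p → n < p → + p ∣ᶻ + m ℤ.- + n → m ≡ n
    close⇒≡ {suc p} {m} {n} (s≤s m≤p) (s≤s n≤p) p∣ =
      ℤ.+-injective (ℤ.i-j≡0⇒i≡j (+ m) (+ n) (ℤ.∣i∣≡0⇒i≡0 (zero-or-large (∣⇒∣ᵤ p∣) (∣+m-+n∣≤ m≤p n≤p))))
      where
      zero-or-large : ∀ {k} → suc p ∣ k → k ≤ p → k ≡ 0
      zero-or-large {zero}  _ _ = refl
      zero-or-large {suc k} d k≤p = ⊥-elim (<-irrefl refl (<-≤-trans (s≤s k≤p) (∣⇒≤ d)))

  module _ (p : ℕ) .{{_ : NonZero p}} where

    toℕ-residue : ∀ a → toℕ (residue a p) ≡ a %ℕ p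
    toℕ-residue a = Fin.toℕ-fromℕ< (n%ℕd<d a p)

    residue≡⇒∣ : ∀ {a b} → residue a p ≡ residue b p → + p ∣ᶻ a ℤ.- b
    residue≡⇒∣ {a} {b} eq = divides (a /ℕ p ℤ.- b /ℕ p) (begin
      a ℤ.- b
        ≡⟨ cong₂ ℤ._-_ (a≡a%ℕn+[a/ℕn]*n a p) (a≡a%ℕn+[a/ℕn]*n b p) ⟩
      (+ (a %ℕ p) ℤ.+ a /ℕ p ℤ.* + p) ℤ.- (+ (b %ℕ p) ℤ.+ b /ℕ p ℤ.* + p)
        ≡⟨ cong (λ r → (+ r ℤ.+ a /ℕ p ℤ.* + p) ℤ.- (+ (b %ℕ p) ℤ.+ b /ℕ p ℤ.* + p)) same ⟩
      (+ (b %ℕ p) ℤ.+ a /ℕ p ℤ.* + p) ℤ.- (+ (b %ℕ p) ℤ.+ b /ℕ p ℤ.* + p)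
        ≡⟨ lem (+ (b %ℕ p)) (a /ℕ p) (b /ℕ p) (+ p) ⟩
      (a /ℕ p ℤ.- b /ℕ p) ℤ.* + p ∎)
      where
      open ≡-Reasoning
      same : a %ℕ p ≡ b %ℕ p
      same = trans (sym (toℕ-residue a)) (trans (cong toℕ eq) (toℕ-residue b))
      lem : ∀ r x y p → (r ℤ.+ x ℤ.* p) ℤ.- (r ℤ.+ y ℤ.* p) ≡ (x ℤ.- y) ℤ.* p
      lem = ℤ-Solver.solve-∀

    ∣⇒residue≡ : ∀ {a b} → + p ∣ᶻ a ℤ.- b → residue a p ≡ residue b p
    ∣⇒residue≡ {a} {b} (divides c a-b≡cp) = Fin.toℕ-injective
      (trans (toℕ-residue a) (trans (close⇒≡ (n%ℕd<d a p) (n%ℕd<d b p) p∣) (sym (toℕ-residue b))))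
      where
      open ≡-Reasoning
      r = + (a %ℕ p)
      s = + (b %ℕ p)
      x = a /ℕ p
      y = b /ℕ p
      lem : ∀ r s x y p → r ℤ.- s ≡ ((r ℤ.+ x ℤ.* p) ℤ.- (s ℤ.+ y ℤ.* p)) ℤ.- (x ℤ.- y) ℤ.* p
      lem = ℤ-Solver.solve-∀
      lem′ : ∀ c d p → c ℤ.* p ℤ.- d ℤ.* p ≡ (c ℤ.- d) ℤ.* p
      lem′ = ℤ-Solver.solve-∀
      p∣ : + p ∣ᶻ r ℤ.- s
      p∣ = divides (c ℤ.- (x ℤ.- y)) (begin
        r ℤ.- s
          ≡⟨ lem r s x y (+ p) ⟩
        ((r ℤ.+ x ℤ.* + p) ℤ.- (s ℤ.+ y ℤ.* + p)) ℤ.- (x ℤ.- y) ℤ.* + p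
          ≡⟨ cong₂ (λ a b → (a ℤ.- b) ℤ.- (x ℤ.- y) ℤ.* + p)
               (a≡a%ℕn+[a/ℕn]*n a p) (a≡a%ℕn+[a/ℕn]*n b p) ⟨
        (a ℤ.- b) ℤ.- (x ℤ.- y) ℤ.* + p
          ≡⟨ cong (ℤ._- (x ℤ.- y) ℤ.* + p) a-b≡cp ⟩
        c ℤ.* + p ℤ.- (x ℤ.- y) ℤ.* + p
          ≡⟨ lem′ c (x ℤ.- y) (+ p) ⟩
        (c ℤ.- (x ℤ.- y)) ℤ.* + p ∎)

  injection⇒≤∣S∣ : ∀ {n} k (f : Fin k → Fin n) → (∀ {i j} → f i ≡ f j → i ≡ j) →
    ∀ S → (∀ i → f i ∈ₛ S) → k ≤ ∣ S ∣
  injection⇒≤∣S∣ zero    f inj S f∈S = z≤n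
  injection⇒≤∣S∣ (suc k) f inj S f∈S = ≤-<-trans
    (injection⇒≤∣S∣ k (f ∘ Fin.suc) (Fin.suc-injective ∘ inj) (S - f Fin.zero)
      λ i → x∈p∧x≢y⇒x∈p-y (f∈S (Fin.suc i)) (λ eq → Fin.0≢1+n (sym (inj eq))))
    (x∈p⇒∣p-x∣<∣p∣ (f∈S Fin.zero))

  module _ {p : ℕ} .{{_ : NonZero p}} {I : Subset p} (∣I∣<p : ∣ I ∣ < p) where

    -- The parameter `r` of an interval may a priori go around the circle. If it reached the
    -- cardinality of `I`, the offsets 0, ..., ∣I∣ would give ∣I∣ + 1 elements of `I`, pairwise
    -- distinct because ∣I∣ < p.
    interval-window : ((δ , r , _) : IsIntervalMod p I) → r ℤ.< + ∣ I ∣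
    interval-window (δ , r , I≡) = ℤ.≰⇒> λ ∣I∣≤r → <-irrefl refl
      (injection⇒≤∣S∣ (suc ∣ I ∣) (λ i → residue (δ ℤ.+ + toℕ i) p) injective I λ i →
        Equivalence.from (I≡ _) (+ toℕ i , ℤ.+≤+ z≤n ,
          ℤ.≤-trans (ℤ.+≤+ (s≤s⁻¹ (Fin.toℕ<n i))) ∣I∣≤r , refl))
      where
      lem : ∀ δ x y → (δ ℤ.+ x) ℤ.- (δ ℤ.+ y) ≡ x ℤ.- y
      lem = ℤ-Solver.solve-∀
      injective : ∀ {i j : Fin (suc ∣ I ∣)} →
        residue (δ ℤ.+ + toℕ i) p ≡ residue (δ ℤ.+ + toℕ j) p → i ≡ j
      injective {i} {j} eq = Fin.toℕ-injective (close⇒≡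
        (≤-<-trans (s≤s⁻¹ (Fin.toℕ<n i)) ∣I∣<p) (≤-<-trans (s≤s⁻¹ (Fin.toℕ<n j)) ∣I∣<p)
        (subst (+ p ∣ᶻ_) (lem δ (+ toℕ i) (+ toℕ j))
          (residue≡⇒∣ p {δ ℤ.+ + toℕ i} {δ ℤ.+ + toℕ j} eq)))

    -- `i` and `j` are the offsets of the two residues from the start `δ`; a + k then has offset i +
    -- k.
    positions : IsIntervalMod p I → ∀ a g → residue a p ∈ₛ I → residue (a ℤ.+ + g) p ∈ₛ I →
      ∃[ i ] ∃[ j ] (i < ∣ I ∣ × j < ∣ I ∣ × + p ∣ᶻ + (g + i) ℤ.- + j ×
        (∀ k → i + k ≤ j → residue (a ℤ.+ + k) p ∈ₛ I))
    positions int@(δ , r , I≡) a g a∈I b∈I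
      with Equivalence.to (I≡ _) a∈I | Equivalence.to (I≡ _) b∈I | interval-window int
    ... | + i , _ , i≤r , ai | + j , _ , j≤r , bj | r<∣I∣ =
      i , j , ℤ.drop‿+<+ (ℤ.≤-<-trans i≤r r<∣I∣) , ℤ.drop‿+<+ (ℤ.≤-<-trans j≤r r<∣I∣) ,
      divides (cb ℤ.- ca) difference , inside
      where
      open ≡-Reasoning
      open _∣ᶻ_ (residue≡⇒∣ p {a} {δ ℤ.+ + i} ai) renaming (quotient to ca; equality to ca-eq)
      open _∣ᶻ_ (residue≡⇒∣ p {a ℤ.+ + g} {δ ℤ.+ + j} bj) renaming (quotient to cb; equality to cb-eq)
      lem : ∀ a g i j δ → (g ℤ.+ i) ℤ.- j ≡ ((a ℤ.+ g) ℤ.- (δ ℤ.+ j)) ℤ.- (a ℤ.- (δ ℤ.+ i))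
      lem = ℤ-Solver.solve-∀
      lem′ : ∀ c d p → c ℤ.* p ℤ.- d ℤ.* p ≡ (c ℤ.- d) ℤ.* p
      lem′ = ℤ-Solver.solve-∀
      lem″ : ∀ a k δ i → (a ℤ.+ k) ℤ.- (δ ℤ.+ (i ℤ.+ k)) ≡ a ℤ.- (δ ℤ.+ i)
      lem″ = ℤ-Solver.solve-∀
      difference : + (g + i) ℤ.- + j ≡ (cb ℤ.- ca) ℤ.* + p
      difference = begin
        (+ g ℤ.+ + i) ℤ.- + j
          ≡⟨ lem a (+ g) (+ i) (+ j) δ ⟩
        ((a ℤ.+ + g) ℤ.- (δ ℤ.+ + j)) ℤ.- (a ℤ.- (δ ℤ.+ + i))
          ≡⟨ cong₂ ℤ._-_ cb-eq ca-eq ⟩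
        cb ℤ.* + p ℤ.- ca ℤ.* + p
          ≡⟨ lem′ cb ca (+ p) ⟩
        (cb ℤ.- ca) ℤ.* + p ∎
      inside : ∀ k → i + k ≤ j → residue (a ℤ.+ + k) p ∈ₛ I
      inside k i+k≤j = Equivalence.from (I≡ _) (+ (i + k) , ℤ.+≤+ z≤n , ℤ.≤-trans (ℤ.+≤+ i+k≤j) j≤r ,
        ∣⇒residue≡ p {a ℤ.+ + k} {δ ℤ.+ + (i + k)} (subst (+ p ∣ᶻ_) (sym (lem″ a (+ k) δ (+ i))) (residue≡⇒∣ p {a} {δ ℤ.+ + i} ai)))

    -- `positions` yields a multiple h + D + i - j of `p`. Since i and j are at most D, adding D
    -- turns i - j into the natural number (D - j) + i ≤ 2D.
    gap-residue : IsIntervalMod p I → ∀ a h {D} → ∣ I ∣ ≤ suc D →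
      residue a p ∈ₛ I → residue (a ℤ.+ + (h + D)) p ∈ₛ I → ∃[ j ] (j < suc (2 * D) × p ∣ h + j)
    gap-residue int a h {D} ∣I∣≤1+D a∈I b∈I with positions int a (h + D) a∈I b∈I
    ... | i , j , i<∣I∣ , j<∣I∣ , p∣ , _ =
      (D ∸ j) + i , s≤s (≤-trans (+-mono-≤ (m∸n≤m D j) i≤D) (≤-reflexive (lem D))) , ∣⇒∣ᵤ (subst (+ p ∣ᶻ_) eq p∣)
      where
      i≤D = s≤s⁻¹ (≤-trans i<∣I∣ ∣I∣≤1+D)
      j≤D = s≤s⁻¹ (≤-trans j<∣I∣ ∣I∣≤1+D)
      lem : ∀ D → D + D ≡ 2 * D
      lem = solve-∀
      lem′ : ∀ h i j d → h + (j + d) + i ≡ h + (d + i) + j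
      lem′ = solve-∀
      lem″ : ∀ x j → x ℤ.+ j ℤ.- j ≡ x
      lem″ = ℤ-Solver.solve-∀
      eq : + (h + D + i) ℤ.- + j ≡ + (h + ((D ∸ j) + i))
      eq = begin
        + (h + D + i) ℤ.- + j              ≡⟨ cong (λ d → + (h + d + i) ℤ.- + j) (m+[n∸m]≡n j≤D) ⟨
        + (h + (j + (D ∸ j)) + i) ℤ.- + j  ≡⟨ cong (λ x → + x ℤ.- + j) (lem′ h i j (D ∸ j)) ⟩
        + (h + ((D ∸ j) + i) + j) ℤ.- + j  ≡⟨ lem″ (+ (h + ((D ∸ j) + i))) (+ j) ⟩
        + (h + ((D ∸ j) + i))              ∎
        where open ≡-Reasoning

    -- Both g + i and j are below p, so their congruence is an equality: no wrap-around occurs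
    -- between the two residues.
    short-gap : IsIntervalMod p I → ∀ a {g} → g + ∣ I ∣ ≤ p →
      residue a p ∈ₛ I → residue (a ℤ.+ + g) p ∈ₛ I →
      g < ∣ I ∣ × (∀ k → k ≤ g → residue (a ℤ.+ + k) p ∈ₛ I)
    short-gap int a {g} g+∣I∣≤p a∈I b∈I with positions int a g a∈I b∈I
    ... | i , j , i<∣I∣ , j<∣I∣ , p∣ , inside =
      ≤-<-trans (≤-trans (m≤m+n g i) (≤-reflexive g+i≡j)) j<∣I∣ ,
      λ k k≤g → inside k (≤-trans (+-monoʳ-≤ i k≤g) (≤-reflexive (trans (+-comm i g) g+i≡j)))
      where
      g+i≡j : g + i ≡ j
      g+i≡j = close⇒≡ (<-≤-trans (+-monoʳ-< g i<∣I∣) g+∣I∣≤p) (<-trans j<∣I∣ ∣I∣<p) p∣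

  module _ (S : ℕ → Set) (S? : ∀ n → Dec (S n)) where

    extremes : ∀ M → (∀ n → n < M → ¬ S n) ⊎
      (∃[ a ] ∃[ g ] (S a × S (a + g) × a + g < M × (∀ n → n < M → S n → a ≤ n × n ≤ a + g)))
    extremes zero = inj₁ λ _ ()
    extremes (suc M) with S? M | extremes M
    ... | no ¬SM | inj₁ none = inj₁ λ n n<1+M Sn → case-< n<1+M Sn none
      where
      case-< : ∀ {n} → n < suc M → S n → (∀ n → n < M → ¬ S n) → ⊥
      case-< (s≤s n≤M) Sn none with m≤n⇒m<n∨m≡n n≤M
      ... | inj₁ n<M  = none _ n<M Sn
      ... | inj₂ refl = ¬SM Sn
    ... | no ¬SM | inj₂ (a , g , Sa , Sb , b<M , bounds) =
      inj₂ (a , g , Sa , Sb , m<n⇒m<1+n b<M , λ { n (s≤s n≤M) Sn → bounds n (<M n≤M Sn) Sn })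
      where
      <M : ∀ {n} → n ≤ M → S n → n < M
      <M n≤M Sn = ≤∧≢⇒< n≤M λ { refl → ¬SM Sn }
    ... | yes SM | inj₁ none =
      inj₂ (M , 0 , SM , subst S (sym (+-identityʳ M)) SM , s≤s (≤-reflexive (+-identityʳ M)) ,
        λ { n (s≤s n≤M) Sn → ≮⇒≥ (λ n<M → none n n<M Sn) , ≤-trans n≤M (m≤m+n M 0) })
    ... | yes SM | inj₂ (a , g , Sa , Sb , b<M , bounds) =
      inj₂ (a , M ∸ a , Sa , subst S (sym a+) SM , s≤s (≤-reflexive a+) ,
        λ { n (s≤s n≤M) Sn → a≤ n n≤M Sn , ≤-trans n≤M (≤-reflexive (sym a+)) })
      where
      a≤M = ≤-trans (m≤m+n a g) (<⇒≤ b<M)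
      a+ : a + (M ∸ a) ≡ M
      a+ = m+[n∸m]≡n a≤M
      a≤ : ∀ n → n ≤ M → S n → a ≤ n
      a≤ n n≤M Sn with m≤n⇒m<n∨m≡n n≤M
      ... | inj₁ n<M  = proj₁ (bounds n n<M Sn)
      ... | inj₂ refl = a≤M

-- Calculus of Dedekind cuts

module Cuts where

  open import Defs
  open import Data.Empty using (⊥-elim)
  open import Data.Integer as ℤ using (+_)
  open import Data.Nat as ℕ using (ℕ; suc)
  import Data.Nat.Properties as ℕ
  open import Data.Product using (∃-syntax; _×_; _,_; proj₁; proj₂)
  open import Data.Rational as ℚ using (ℚ; 0ℚ; 1ℚ)
  import Data.Rational.Properties as ℚ
  open import Data.Sum using (inj₁; inj₂)
  open import Relation.Binary.Definitions using (tri<; tri≈; tri>)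
  open import Relation.Binary.PropositionalEquality
  open import Relation.Nullary.Decidable using (from-yes)
  open import Tactic.RingSolver using (solve-∀)
  open RationalArithmetic renaming (_^_ to _^ℚ_)
  open ExponentialSeries

  private variable
    x z : Cut
    a b c d q r t : ℚ

  a<a+1 : ∀ a → a ℚ.< a ℚ.+ 1ℚ
  a<a+1 a = subst (ℚ._< a ℚ.+ 1ℚ) (ℚ.+-identityʳ a) (ℚ.+-monoʳ-< a (from-yes (0ℚ ℚ.<? 1ℚ)))

  expℚ-upper : (∀ n → expSum t n ℚ.≤ r) → r ℚ.< q → upper (expℚ t) q
  expℚ-upper {r = r} ≤r r<q = r , r<q , 0 , λ n _ → ≤r n

  -- For t ≥ 0 the partial sums increase, so a bound that holds eventually holds for all of them.
  expℚ-upper⁻ : 0ℚ ℚ.≤ t → upper (expℚ t) q → ∀ n → expSum t n ℚ.< q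
  expℚ-upper⁻ 0≤t (r , r<q , m , ≤r) n =
    ℚ.≤-<-trans (ℚ.≤-trans (expSum-monoʳ 0≤t (ℕ.m≤n+m n m)) (≤r (m ℕ.+ n) (ℕ.m≤m+n m n))) r<q

  expℚ-lower : 0ℚ ℚ.≤ t → ∀ n → q ℚ.< expSum t n → lower (expℚ t) q
  expℚ-lower {t} 0≤t n q< = expSum t n , q< , n , λ _ → expSum-monoʳ 0≤t

  expℚ-lower⁻ : lower (expℚ t) q → ∃[ n ] q ℚ.< expSum t n
  expℚ-lower⁻ (r , q<r , n , r≤) = n , ℚ.<-≤-trans q<r (r≤ n ℕ.≤-refl)

  expℚ-lower-closed : q ℚ.≤ r → lower (expℚ t) r → lower (expℚ t) q
  expℚ-lower-closed q≤r (s , r<s , s≤) = s , ℚ.≤-<-trans q≤r r<s , s≤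

  -- A rational below (1 - ε) log z may be negative, whereas the estimates of partial sums are for
  -- nonnegative arguments. A value of at least 1 below exp t settles the sign of t.
  expℚ-lower-≥1 : 1ℚ ℚ.≤ q → lower (expℚ t) q → 0ℚ ℚ.≤ t
  expℚ-lower-≥1 {t = t} 1≤q (r , q<r , m , r≤) = ℚ.≮⇒≥ λ t<0 →
    expSum-neg≤1 {ℚ.- t} (ℚ.neg-antimono-≤ (ℚ.<⇒≤ t<0)) (ℚ.≤-<-trans 1≤q q<r) m
      λ n m≤n → subst (λ s → r ℚ.≤ expSum s n) (sym (neg-neg t)) (r≤ n m≤n)
    where
    neg-neg : ∀ t → ℚ.- (ℚ.- t) ≡ t
    neg-neg = solve-∀ ring

  Positive : Cut → Set
  Positive x = ∃[ a ] (0ℚ ℚ.< a × lower x a)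

  -- Every rational is below some upper bound: this supplies the upper bounds
  -- that the lower cut of a product asks for.
  Unbounded : Cut → Set
  Unbounded x = ∀ a → ∃[ b ] (a ℚ.≤ b × upper x b)

  -- With a and c nonnegative, `a * c` is the least of the four products in the definition of `*`.
  *-lower : Unbounded x → Unbounded z → 0ℚ ℚ.≤ a → lower x a → 0ℚ ℚ.≤ c → lower z c →
            q ℚ.< a ℚ.* c → lower (x * z) q
  *-lower {a = a} {c = c} ux uz 0≤a a<x 0≤c c<z q<ac with ux a | uz c
  ... | b , a≤b , x<b | d , c≤d , z<d =
    a , b , c , d , a<x , x<b , c<z , z<d , q<ac ,
    ℚ.<-≤-trans q<ac (*-monoʳ 0≤a c≤d) ,
    ℚ.<-≤-trans q<ac (*-monoˡ 0≤c a≤b) ,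
    ℚ.<-≤-trans q<ac (*-mono 0≤a a≤b 0≤c c≤d)

  *-upper : 0ℚ ℚ.≤ a → a ℚ.≤ b → lower x a → upper x b →
            0ℚ ℚ.≤ c → c ℚ.≤ d → lower z c → upper z d →
            b ℚ.* d ℚ.< q → upper (x * z) q
  *-upper {a = a} {b = b} {c = c} {d = d} 0≤a a≤b a<x x<b 0≤c c≤d c<z z<d bd<q =
    a , b , c , d , a<x , x<b , c<z , z<d ,
    ℚ.≤-<-trans (*-mono 0≤a a≤b 0≤c c≤d) bd<q ,
    ℚ.≤-<-trans (*-monoˡ (ℚ.≤-trans 0≤c c≤d) a≤b) bd<q ,
    ℚ.≤-<-trans (*-monoʳ (ℚ.≤-trans 0≤a a≤b) c≤d) bd<q ,
    bd<q

  *-unbounded : Positive x → Unbounded x → Positive z → Unbounded z → Unbounded (x * z)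
  *-unbounded {x} {z} (a , 0<a , a<x) ux (c , 0<c , c<z) uz e with ux a | uz c
  ... | b , a≤b , x<b | d , c≤d , z<d =
    e ℚ.⊔ (b ℚ.* d ℚ.+ 1ℚ) , ℚ.p≤p⊔q e _ ,
    *-upper {x = x} {z = z} (ℚ.<⇒≤ 0<a) a≤b a<x x<b (ℚ.<⇒≤ 0<c) c≤d c<z z<d
      (ℚ.<-≤-trans (a<a+1 (b ℚ.* d)) (ℚ.p≤q⊔p e _))

  private
    lower-⊔ : lower x a → lower x b → lower x (a ℚ.⊔ b)
    lower-⊔ {x} {a} {b} a<x b<x with ℚ.≤-total a b
    ... | inj₁ a≤b = subst (lower x) (sym (ℚ.p≤q⇒p⊔q≡q a≤b)) b<x
    ... | inj₂ b≤a = subst (lower x) (sym (ℚ.p≥q⇒p⊔q≡p b≤a)) a<x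

  -- The rationals that witness a lower bound of a product may be negative; taking maxima with known
  -- positive lower bounds repairs this. If c ≤ 0, then q lies below b c ≤ 0, as b is nonnegative;
  -- if a ≤ 0 ≤ c, then q lies below a c ≤ 0.
  *-lower⁻ : Positive x → Positive z → (∀ b → upper x b → 0ℚ ℚ.≤ b) → lower (x * z) q →
             ∃[ a ] ∃[ c ] (0ℚ ℚ.< a × lower x a × 0ℚ ℚ.< c × lower z c × q ℚ.< a ℚ.* c)
  *-lower⁻ {x} {z} (a₀ , 0<a₀ , a₀<x) (c₀ , 0<c₀ , c₀<z) 0≤upper
    (a , b , c , d , a<x , x<b , c<z , z<d , q<ac , q<ad , q<bc , q<bd) =
    a ℚ.⊔ a₀ , c ℚ.⊔ c₀ , 0<A , lower-⊔ {x} a<x a₀<x , 0<C , lower-⊔ {z} c<z c₀<z , q<AC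
    where
    0<A = ℚ.<-≤-trans 0<a₀ (ℚ.p≤q⊔p a a₀)
    0<C = ℚ.<-≤-trans 0<c₀ (ℚ.p≤q⊔p c c₀)
    0≤AC = ℚ.<⇒≤ (*-positive 0<A 0<C)
    q<AC : _ ℚ.< (a ℚ.⊔ a₀) ℚ.* (c ℚ.⊔ c₀)
    q<AC with ℚ.≤-total c 0ℚ | ℚ.≤-total a 0ℚ
    ... | inj₁ c≤0 | _ = ℚ.<-≤-trans q<bc (ℚ.≤-trans
      (subst (b ℚ.* c ℚ.≤_) (ℚ.*-zeroʳ b) (*-monoʳ (0≤upper b x<b) c≤0)) 0≤AC)
    ... | inj₂ 0≤c | inj₁ a≤0 = ℚ.<-≤-trans q<ac (ℚ.≤-trans
      (subst (a ℚ.* c ℚ.≤_) (ℚ.*-zeroˡ c) (*-monoˡ 0≤c a≤0)) 0≤AC)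
    ... | inj₂ 0≤c | inj₂ 0≤a =
      ℚ.<-≤-trans q<ac (*-mono 0≤a (ℚ.p≤p⊔q a a₀) 0≤c (ℚ.p≤p⊔q c c₀))

  rat-unbounded : ∀ a → Unbounded (rat a)
  rat-unbounded a e = e ℚ.⊔ (a ℚ.+ 1ℚ) , ℚ.p≤p⊔q e _ , ℚ.<-≤-trans (a<a+1 a) (ℚ.p≤q⊔p e _)

  nat-unbounded : ∀ n → Unbounded (nat n)
  nat-unbounded n = rat-unbounded (ι n)

  real-ordered : IsReal x → lower x a → upper x b → a ℚ.< b
  real-ordered {a = a} {b} R a<x x<b with ℚ.<-cmp a b
  ... | tri< a<b _ _    = a<b
  ... | tri≈ _ refl _   = ⊥-elim (IsReal.disjoint R a<x x<b)
  ... | tri> _ _ b<a    = ⊥-elim (IsReal.disjoint R a<x (IsReal.upper-closed R b<a x<b))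

  real-unbounded : IsReal x → Unbounded x
  real-unbounded R a with IsReal.upper-inhabited R
  ... | b , x<b = (a ℚ.⊔ (b ℚ.+ 1ℚ)) , ℚ.p≤p⊔q a _ ,
    IsReal.upper-closed R (ℚ.<-≤-trans (a<a+1 b) (ℚ.p≤q⊔p a _)) x<b

  exp-unbounded : Unbounded x → Unbounded (exp x)
  exp-unbounded ux e with ux 0ℚ
  ... | b , 0≤b , x<b with ≤ι b
  ... | k , b≤k = e ℚ.⊔ (ι (3 ℕ.^ k) ℚ.+ 1ℚ) , ℚ.p≤p⊔q e _ , b , x<b ,
    expℚ-upper (λ n → ℚ.≤-trans (expSum-mono 0≤b b≤k n) (expSum-ι≤3^ k n))
      (ℚ.<-≤-trans (a<a+1 (ι (3 ℕ.^ k))) (ℚ.p≤q⊔p e _))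

  log-lower : (∀ n → expSum t n ℚ.≤ r) → r ℚ.< q → lower z q → lower (log z) t
  log-lower ≤r r<q q<z = _ , expℚ-upper ≤r r<q , q<z

  log-upper : 0ℚ ℚ.≤ t → ∀ n → q ℚ.< expSum t n → upper z q → upper (log z) t
  log-upper 0≤t n q< z<q = _ , z<q , expℚ-lower 0≤t n q<

  log-nat-lower⁻ : ∀ k → 0ℚ ℚ.≤ t → lower (log (nat k)) t → ∀ n → expSum t n ℚ.≤ ι k
  log-nat-lower⁻ k 0≤t (q , exp<q , q<k) n = ℚ.<⇒≤ (ℚ.<-trans (expℚ-upper⁻ 0≤t exp<q n) q<k)

  -- Two terms, 1 + k, already exceed k. So a sufficiently large exponent can always be named
  -- without estimating a logarithm.
  q<expSum-ι : ∀ k → ι k ℚ.< expSum (ι k) 2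
  q<expSum-ι k = subst (ι k ℚ.<_) (trans (ℚ.+-comm (ι k) 1ℚ) (sym (expSum-2 (ι k)))) (a<a+1 (ι k))

  log-unbounded : Unbounded z → Unbounded (log z)
  log-unbounded {z} uz a with uz a
  ... | b , a≤b , z<b with ≤ι b
  ... | k , b≤k = ι k , ℚ.≤-trans a≤b b≤k ,
    log-upper {z = z} (0≤ι k) 2 (ℚ.≤-<-trans b≤k (q<expSum-ι k)) z<b

  ⁻¹-unbounded : Positive x → Unbounded (x ⁻¹)
  ⁻¹-unbounded (r , 0<r , r<x) a = a ℚ.⊔ (r⁻¹ ℚ.+ 1ℚ) , ℚ.p≤p⊔q a _ , r , 0<r , r<x ,
    subst (ℚ._< (a ℚ.⊔ (r⁻¹ ℚ.+ 1ℚ)) ℚ.* r) (ℚ.*-inverseˡ r {{r≢0}})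
      (*-monoˡ-< 0<r (ℚ.<-≤-trans (a<a+1 r⁻¹) (ℚ.p≤q⊔p a _)))
    where
    r≢0 = ℚ.>-nonZero 0<r
    r⁻¹ = (ℚ.1/ r) {{r≢0}}

  complement-unbounded : IsReal x → Unbounded (nat 1 - x)
  complement-unbounded {x} R a with IsReal.lower-inhabited R
  ... | e , e<x = ((a ℚ.+ e) ℚ.⊔ ι 2) ℚ.+ (ℚ.- e) ,
    subst (ℚ._≤ ((a ℚ.+ e) ℚ.⊔ ι 2) ℚ.+ (ℚ.- e)) (lem a e) (ℚ.+-monoˡ-≤ (ℚ.- e) (ℚ.p≤p⊔q (a ℚ.+ e) (ι 2))) ,
    (a ℚ.+ e) ℚ.⊔ ι 2 , ℚ.- e , ℚ.<-≤-trans (ι-mono-< {1} {2} ℕ.≤-refl) (ℚ.p≤q⊔p (a ℚ.+ e) (ι 2)) ,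
    subst (lower x) (sym (lem′ e)) e<x , refl
    where
    lem : ∀ a e → a ℚ.+ e ℚ.+ (ℚ.- e) ≡ a
    lem = solve-∀ ring
    lem′ : ∀ e → ℚ.- (ℚ.- e) ≡ e
    lem′ = solve-∀ ring

  complement-lower⁻ : IsReal x → lower x c → lower (nat 1 - x) q → q ℚ.≤ 1ℚ ℚ.- c
  complement-lower⁻ {c = c} R c<x (a , b , a<1 , x<-b , refl) =
    ℚ.<⇒≤ (ℚ.+-mono-< a<1 (subst (ℚ._< ℚ.- c) (neg-neg b) (ℚ.neg-antimono-< (real-ordered R c<x x<-b))))
    where
    neg-neg : ∀ a → ℚ.- (ℚ.- a) ≡ a
    neg-neg = solve-∀ ring

  complement-upper-nonneg : IsReal x → upper x 1ℚ → ∀ b → upper (nat 1 - x) b → 0ℚ ℚ.≤ b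
  complement-upper-nonneg {x = x} R x<1 c (a , b , 1<a , -b<x , c≡a+b) =
    subst₂ ℚ._≤_ (lem b) (sym c≡a+b)
      (ℚ.+-monoˡ-≤ b (ℚ.<⇒≤ (ℚ.<-trans (real-ordered R -b<x x<1) 1<a)))
    where
    lem : ∀ b → ℚ.- b ℚ.+ b ≡ 0ℚ
    lem = solve-∀ ring

  complement-positive : x < nat 1 → Positive (nat 1 - x)
  complement-positive {x = x} (q , x<q , q<1) with ℚ.<-dense q<1
  ... | r , q<r , r<1 = r ℚ.- q , subst (ℚ._< r ℚ.- q) (lem q) (ℚ.+-monoˡ-< (ℚ.- q) q<r) ,
    r , ℚ.- q , r<1 , subst (upper x) (sym (neg-neg q)) x<q , refl
    where
    neg-neg : ∀ a → ℚ.- (ℚ.- a) ≡ a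
    neg-neg = solve-∀ ring
    lem : ∀ b → b ℚ.- b ≡ 0ℚ
    lem = solve-∀ ring

  -- The origin of the recurring threshold 4: exp 1 ≤ 3 < 4, so the logarithm exceeds 1 and is in
  -- particular positive.
  1<log : lower z (ι 4) → lower (log z) 1ℚ
  1<log {z} 4<z = log-lower {t = 1ℚ} {r = ι 3} {q = ι 4} {z = z} expSum-1≤3 (ι-mono-< {3} {4} ℕ.≤-refl) 4<z

  log-positive : lower z (ι 4) → Positive (log z)
  log-positive {z} 4<z = 1ℚ , from-yes (0ℚ ℚ.<? 1ℚ) , 1<log {z} 4<z

  log-mono : z ≤ x → lower (log z) t → lower (log x) t
  log-mono z≤x (q , exp<q , q<z) = q , exp<q , z≤x q q<z

  private
    module Exponent {x : Cut} (R : IsReal x) (x<1 : x < nat 1) where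
      α : Cut
      α = nat 1 - x

      α-positive : Positive α
      α-positive = complement-positive {x} x<1

      α-unbounded : Unbounded α
      α-unbounded = complement-unbounded {x} R

      α-upper-nonneg : ∀ b → upper α b → 0ℚ ℚ.≤ b
      α-upper-nonneg = let s , x<s , s<1 = x<1 in
        complement-upper-nonneg {x} R (IsReal.upper-closed R s<1 x<s)

      α*log-lower⁻ : lower z (ι 4) → lower (α * log z) t →
        ∃[ a ] ∃[ c ] (0ℚ ℚ.< a × lower α a × 0ℚ ℚ.< c × lower (log z) c × t ℚ.< a ℚ.* c)
      α*log-lower⁻ {z} 4<z = *-lower⁻ {α} {log z} α-positive (log-positive {z} 4<z) α-upper-nonneg

  -- Positive rationals below `1 - x` and `log z` remain lower bounds when `z` is replaced by `z′`,
  -- so the same `t` serves both powers.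
  ^-mono-lower : IsReal x → x < nat 1 → ∀ {z z′} → z ≤ z′ → lower z (ι 4) → Unbounded z′ →
                 lower (z ^ (nat 1 - x)) q → lower (z′ ^ (nat 1 - x)) q
  ^-mono-lower {x} R x<1 {z} {z′} z≤z′ 4<z uz′ (t , t<αlog , q<expt) =
    let open Exponent {x} R x<1
        a , c , 0<a , a<α , 0<c , c<log , t<ac = α*log-lower⁻ {z} 4<z t<αlog
    in t , *-lower {α} {log z′} α-unbounded (log-unbounded {z′} uz′) (ℚ.<⇒≤ 0<a) a<α
             (ℚ.<⇒≤ 0<c) (log-mono {z} {z′} z≤z′ c<log) t<ac ,
       q<expt

  1≤^-lower : IsReal x → x < nat 1 → lower z (ι 4) → Unbounded z → q ℚ.< 1ℚ →
              lower (z ^ (nat 1 - x)) q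
  1≤^-lower {x} {z} R x<1 4<z uz q<1 =
    let open Exponent {x} R x<1
        a , 0<a , a<α = α-positive
    in 0ℚ , *-lower {α} {log z} α-unbounded (log-unbounded {z} uz) (ℚ.<⇒≤ 0<a) a<α 0≤1 (1<log {z} 4<z)
             (subst (0ℚ ℚ.<_) (sym (ℚ.*-identityʳ a)) 0<a) ,
       expℚ-lower ℚ.≤-refl 1 q<1

  -- The conclusion is a ≤ n ^ (k / (k + 1)), cleared of the rational exponent.
  ^-lower-bound : IsReal x → x < nat 1 → ∀ {e} → lower x e → ∀ k → 1ℚ ℚ.≤ ι (suc k) ℚ.* e →
    ∀ n → 4 ℕ.< n → 1ℚ ℚ.≤ a → lower (nat n ^ (nat 1 - x)) a → a ^ℚ suc k ℚ.≤ ι (n ℕ.^ k)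
  ^-lower-bound {x} {a} R x<1 {e} e<x k 1≤ke n 4<n 1≤a (t , t<αlog , a<expt) = begin
    a ^ℚ suc k                                   ≤⟨ ^-mono (suc k) (ℚ.≤-trans 0≤1 1≤a) (ℚ.<⇒≤ a<E) ⟩
    expSum t m ^ℚ suc k                          ≤⟨ expSum-*-≥ 0≤t (suc k) m ⟩
    expSum (ι (suc k) ℚ.* t) m′                  ≤⟨ expSum-mono (*-nonneg (0≤ι (suc k)) 0≤t) Mt≤kv m′ ⟩
    expSum (ι k ℚ.* v) m′                        ≤⟨ expSum-*-≤ 0≤v k m′ ⟩
    expSum v m′ ^ℚ k                             ≤⟨ ^-mono k (expSum-nonneg 0≤v m′) (log-nat-lower⁻ n 0≤v v<log m′) ⟩
    ι n ^ℚ k                                     ≡⟨ ι-homo-^ n k ⟨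
    ι (n ℕ.^ k)                                  ∎
    where
    open ℚ.≤-Reasoning
    open Exponent {x} R x<1
    factors = α*log-lower⁻ {nat n} (ι-mono-< {4} {n} 4<n) t<αlog
    u = proj₁ factors
    v = proj₁ (proj₂ factors)
    u<α = proj₁ (proj₂ (proj₂ (proj₂ factors)))
    0<v = proj₁ (proj₂ (proj₂ (proj₂ (proj₂ factors))))
    v<log = proj₁ (proj₂ (proj₂ (proj₂ (proj₂ (proj₂ factors)))))
    t<uv = proj₂ (proj₂ (proj₂ (proj₂ (proj₂ (proj₂ factors)))))
    m = proj₁ (expℚ-lower⁻ {t} a<expt)
    a<E = proj₂ (expℚ-lower⁻ {t} a<expt)
    m′ = suc (suc k ℕ.* m)
    0≤t = expℚ-lower-≥1 {t = t} 1≤a a<expt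
    0≤v = ℚ.<⇒≤ 0<v
    lem : ∀ k e v → (1ℚ ℚ.+ k) ℚ.* ((1ℚ ℚ.- e) ℚ.* v) ≡ (1ℚ ℚ.- (1ℚ ℚ.+ k) ℚ.* e) ℚ.* v ℚ.+ k ℚ.* v
    lem = solve-∀ ring
    lem′ : ∀ a b w → (a ℚ.- a) ℚ.* b ℚ.+ w ≡ w
    lem′ = solve-∀ ring
    -- From u ≤ 1 - e and (k + 1) e ≥ 1 it follows that (k + 1) u ≤ k.
    Mt≤kv : ι (suc k) ℚ.* t ℚ.≤ ι k ℚ.* v
    Mt≤kv = begin
      ι (suc k) ℚ.* t
        ≤⟨ *-monoʳ (0≤ι (suc k)) (ℚ.<⇒≤ t<uv) ⟩
      ι (suc k) ℚ.* (u ℚ.* v)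
        ≤⟨ *-monoʳ (0≤ι (suc k)) (*-monoˡ 0≤v (complement-lower⁻ {x} R e<x u<α)) ⟩
      ι (suc k) ℚ.* ((1ℚ ℚ.- e) ℚ.* v)
        ≡⟨ cong (ℚ._* ((1ℚ ℚ.- e) ℚ.* v)) (ι-suc k) ⟩
      (1ℚ ℚ.+ ι k) ℚ.* ((1ℚ ℚ.- e) ℚ.* v)
        ≡⟨ lem (ι k) e v ⟩
      (1ℚ ℚ.- (1ℚ ℚ.+ ι k) ℚ.* e) ℚ.* v ℚ.+ ι k ℚ.* v
        ≡⟨ cong (λ w → (1ℚ ℚ.- w ℚ.* e) ℚ.* v ℚ.+ ι k ℚ.* v) (ι-suc k) ⟨
      (1ℚ ℚ.- ι (suc k) ℚ.* e) ℚ.* v ℚ.+ ι k ℚ.* v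
        ≤⟨ ℚ.+-monoˡ-≤ (ι k ℚ.* v) (*-monoˡ 0≤v (ℚ.+-monoʳ-≤ 1ℚ (ℚ.neg-antimono-≤ 1≤ke))) ⟩
      (1ℚ ℚ.- 1ℚ) ℚ.* v ℚ.+ ι k ℚ.* v
        ≡⟨ lem′ 1ℚ v (ι k ℚ.* v) ⟩
      ι k ℚ.* v ∎

open import Defs
open import Data.Empty using (⊥; ⊥-elim)
open import Data.Fin.Subset using (Subset; ∣_∣) renaming (_∈_ to _∈ₛ_)
open import Data.Fin.Subset.Properties using (_∈?_)
open import Data.Integer as ℤ using (ℤ; +_; -[1+_])
import Data.Integer.Properties as ℤ
open import Data.List using (List; []; _∷_; length)
open import Data.List.Membership.Propositional using (_∈_)
open import Data.List.Relation.Unary.All as All using (All; []; _∷_)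
open import Data.List.Relation.Unary.Any using (here; there)
open import Data.List.Relation.Unary.Unique.Propositional using (Unique)
open import Data.Nat as ℕ using (ℕ; zero; suc; NonZero) renaming (_<_ to _<ℕ_)
open import Data.Nat.Divisibility using () renaming (_∣_ to _∣ℕ_)
open import Data.Nat.Primality using (Prime; prime⇒nonZero)
import Data.Nat.Properties as ℕ
import Data.Nat.Tactic.RingSolver as ℕ-Solver
open import Data.Product using (Σ-syntax; ∃-syntax; _×_; _,_; proj₁; proj₂)
open import Data.Rational as ℚ using (ℚ; 0ℚ; 1ℚ)
import Data.Rational.Properties as ℚ
open import Data.Sum using (_⊎_; inj₁; inj₂)
open import Function using (_∘_)
open import Function.Bundles using (_⇔_; mk⇔)
open import Relation.Binary.PropositionalEquality
open import Relation.Nullary using (¬_; Dec; yes; no)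
open import Relation.Nullary.Decidable using (from-yes; map′)
open import Tactic.RingSolver using (solve-∀)
open RationalArithmetic renaming (_^_ to _^ℚ_)
open ExponentialSeries
open PrimesAndResidues
open Cuts

-- Bounds on logarithms, and on y from below

private variable
  x : Cut
  a b t : ℚ

-- `≤` speaks of lower cuts alone; locatedness between `a` and `b` produces the upper bound.
upper-of-≤ : IsReal x → x ≤ rat a → a ℚ.< b → upper x b
upper-of-≤ R x≤a a<b with IsReal.located R a<b
... | inj₁ a<x = ⊥-elim (ℚ.<-irrefl refl (x≤a _ a<x))
... | inj₂ x<b = x<b

log-upper-of-≤ : IsReal x → x ≤ rat a → 0ℚ ℚ.≤ t → ∀ n → a ℚ.< expSum t n → upper (log x) t
log-upper-of-≤ {x} {a} {t} R x≤a 0≤t n a<E =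
  let q , a<q , q<E = ℚ.<-dense a<E
  in log-upper {t = t} {z = x} 0≤t n q<E (upper-of-≤ {x} R x≤a a<q)

log-nat-lower : ∀ {k m} → (∀ n → expSum t n ℚ.≤ ι k) → k ℕ.< m → lower (log (nat m)) t
log-nat-lower {t} {k} {m} E≤k k<m =
  let q , k<q , q<m = ℚ.<-dense (ι-mono-< {k} {m} k<m)
  in log-lower {t} {ι k} {q} {nat m} E≤k k<q q<m

-- Crude estimates suffice. N > 3 ^ l gives log N > l, so 16 log N exceeds 3 ^ c + 1 and its
-- logarithm exceeds c = 2 (C + 1). The exponent 1 / x is above 1/2, so the power is exp of more
-- than C, and exp C > C.
base-lower : ∀ {x} → IsReal x → nat 0 < x → x < nat 1 →
  ∀ C {N} → 3 ℕ.^ (3 ℕ.^ (2 ℕ.* suc C) ℕ.+ 2) ℕ.< N →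
  lower ((nat 16 * log (nat N)) ^ (nat 1 / x)) (ι C)
base-lower {x} R (e , 0<e , e<x) (s , x<s , s<1) C {N} big =
  ι C , *-lower {nat 1 / x} {log B} 1/x-unbounded (log-unbounded {B} B-unbounded)
    (from-yes (0ℚ ℚ.≤? ℚ.½)) ½<1/x (0≤ι c) c<logB C<½c ,
  expℚ-lower (0≤ι C) 2 (q<expSum-ι C)
  where
  c = 2 ℕ.* suc C
  B = nat 16 * log (nat N)
  l = 3 ℕ.^ c ℕ.+ 2
  4<N : 4 ℕ.< N
  4<N = ℕ.<-trans (ℕ.<-≤-trans (ℕ.s≤s (ℕ.s≤s (ℕ.s≤s (ℕ.s≤s (ℕ.s≤s ℕ.z≤n)))))
    (ℕ.^-monoʳ-≤ 3 {2} (ℕ.m≤n+m 2 (3 ℕ.^ c)))) big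
  log-N-unbounded = log-unbounded {nat N} (nat-unbounded N)
  log-N-positive = log-positive {nat N} (ι-mono-< {4} {N} 4<N)
  16-positive : Positive (nat 16)
  16-positive = 1ℚ , from-yes (0ℚ ℚ.<? 1ℚ) , from-yes (1ℚ ℚ.<? ι 16)
  B-unbounded : Unbounded B
  B-unbounded = *-unbounded {nat 16} {log (nat N)}
    16-positive (nat-unbounded 16) log-N-positive log-N-unbounded
  l<logN : lower (log (nat N)) (ι l)
  l<logN = log-nat-lower {ι l} {3 ℕ.^ l} {N} (expSum-ι≤3^ l) big
  c<logB : lower (log B) (ι c)
  c<logB = log-lower {ι c} {ι (3 ℕ.^ c)} {ι (3 ℕ.^ c ℕ.+ 1)} {B} (expSum-ι≤3^ c)
    (ι-mono-< {3 ℕ.^ c} {3 ℕ.^ c ℕ.+ 1} (ℕ.m<m+n (3 ℕ.^ c) (ℕ.s≤s ℕ.z≤n)))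
    (*-lower {nat 16} {log (nat N)} (nat-unbounded 16) log-N-unbounded
      0≤1 (from-yes (1ℚ ℚ.<? ι 16)) (0≤ι l) l<logN
      (subst (ι (3 ℕ.^ c ℕ.+ 1) ℚ.<_) (sym (ℚ.*-identityˡ (ι l)))
        (ι-mono-< {3 ℕ.^ c ℕ.+ 1} {l} (ℕ.+-monoʳ-< (3 ℕ.^ c) (ℕ.n<1+n 1)))))
  ¾ = + 3 ℚ./ 4
  1<1/x : lower (x ⁻¹) 1ℚ
  1<1/x = s , ℚ.<-trans 0<e (real-ordered {x} R e<x x<s) , x<s ,
    subst (ℚ._< 1ℚ) (sym (ℚ.*-identityˡ s)) s<1
  1/x-unbounded′ = ⁻¹-unbounded {x} (e , 0<e , e<x)
  ½<1/x : lower (nat 1 / x) ℚ.½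
  ½<1/x = *-lower {nat 1} {x ⁻¹} (nat-unbounded 1) 1/x-unbounded′
    (from-yes (0ℚ ℚ.≤? ¾)) (from-yes (¾ ℚ.<? 1ℚ)) 0≤1 1<1/x (from-yes (ℚ.½ ℚ.<? ¾ ℚ.* 1ℚ))
  1/x-unbounded : Unbounded (nat 1 / x)
  1/x-unbounded = *-unbounded {nat 1} {x ⁻¹}
    (¾ , from-yes (0ℚ ℚ.<? ¾) , from-yes (¾ ℚ.<? 1ℚ)) (nat-unbounded 1)
    (1ℚ , from-yes (0ℚ ℚ.<? 1ℚ) , 1<1/x) 1/x-unbounded′
  C<½c : ι C ℚ.< ℚ.½ ℚ.* ι c
  C<½c = subst (ι C ℚ.<_)
    (sym (trans (cong (ℚ.½ ℚ.*_) (ι-homo-* 2 (suc C)))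
      (trans (sym (ℚ.*-assoc ℚ.½ (ι 2) (ι (suc C)))) (ℚ.*-identityˡ (ι (suc C))))))
    (ι-mono-< {C} {suc C} (ℕ.n<1+n C))

-- Any rational below 1 with 8 θ ^ 6 ≥ 7 would do.
θ : ℚ
θ = + 63 ℚ./ 64

0<θ : 0ℚ ℚ.< θ
0<θ = from-yes (0ℚ ℚ.<? θ)

θ*< : 0ℚ ℚ.< a → θ ℚ.* a ℚ.< a
θ*< {a} 0<a = subst (θ ℚ.* a ℚ.<_) (ℚ.*-identityˡ a) (*-monoˡ-< 0<a (from-yes (θ ℚ.<? 1ℚ)))

-- The lower bound on the number of primes

module Counting
  {x} (Rx : IsReal x) (x<1 : x < nat 1)
  {y} (Ry : IsReal y) (4<y : lower y (ι 4))
  {N K : ℕ} (4<N : 4 ℕ.< N)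
  (count : nat 4 * (nat 2 * y) ^ (nat 1 - x) * log (nat N) / log y ≤ nat K)
  where

  2y-lower : lower (nat 2 * y) (ι 4)
  2y-lower = let r , 4<r , r<y = IsReal.lower-open Ry 4<y in
    *-lower {nat 2} {y} (nat-unbounded 2) (real-unbounded Ry) 0≤1 (from-yes (1ℚ ℚ.<? ι 2))
      (ℚ.≤-trans (0≤ι 4) (ℚ.<⇒≤ 4<r)) r<y (subst (ι 4 ℚ.<_) (sym (ℚ.*-identityˡ r)) 4<r)

  2y-unbounded : Unbounded (nat 2 * y)
  2y-unbounded = *-unbounded {nat 2} {y}
    (1ℚ , from-yes (0ℚ ℚ.<? 1ℚ) , from-yes (1ℚ ℚ.<? ι 2)) (nat-unbounded 2)
    (ι 4 , from-yes (0ℚ ℚ.<? ι 4) , 4<y) (real-unbounded Ry)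

  power : Cut
  power = (nat 2 * y) ^ (nat 1 - x)

  log-y-positive : Positive (log y)
  log-y-positive = log-positive {y} 4<y

  power-unbounded : Unbounded power
  power-unbounded = exp-unbounded {(nat 1 - x) * log (nat 2 * y)}
    (*-unbounded {nat 1 - x} {log (nat 2 * y)} (complement-positive {x} x<1) (complement-unbounded {x} Rx)
      (log-positive {nat 2 * y} 2y-lower) (log-unbounded {nat 2 * y} 2y-unbounded))

  -- Cuts are open, so every rational below the quotient loses strictly at five places: the constant
  -- 4, the reciprocal of log y, and the three multiplications. Each costs one factor `θ`. The sixth
  -- `θ` comes with the bound on D.
  counting-bound : ∀ {a l u v} → 0ℚ ℚ.< a → lower power a → 0ℚ ℚ.< l → lower (log (nat N)) l →
    0ℚ ℚ.< u → upper (log y) u → 0ℚ ℚ.< v → v ℚ.* u ≡ 1ℚ →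
    (θ ℚ.* θ ℚ.* θ ℚ.* θ ℚ.* θ ℚ.* ι 4) ℚ.* (a ℚ.* l ℚ.* v) ℚ.< ι K
  counting-bound {a} {l} {u} {v} 0<a a<power 0<l l<logN 0<u logy<u 0<v vu≡1 =
    subst (ℚ._< ι K) (lem θ (ι 4) a l v) (count q₃ q₃-lower)
    where
    f = θ ℚ.* ι 4
    q₁ = θ ℚ.* (f ℚ.* a)
    q₂ = θ ℚ.* (q₁ ℚ.* l)
    w = θ ℚ.* v
    q₃ = θ ℚ.* (q₂ ℚ.* w)
    lem : ∀ θ k a l v → θ ℚ.* ((θ ℚ.* ((θ ℚ.* ((θ ℚ.* k) ℚ.* a)) ℚ.* l)) ℚ.* (θ ℚ.* v)) ≡
          (θ ℚ.* θ ℚ.* θ ℚ.* θ ℚ.* θ ℚ.* k) ℚ.* (a ℚ.* l ℚ.* v)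
    lem = solve-∀ ring
    0<f : 0ℚ ℚ.< f
    0<f = from-yes (0ℚ ℚ.<? f)
    f<4 : f ℚ.< ι 4
    f<4 = from-yes (f ℚ.<? ι 4)
    0<fa = *-positive 0<f 0<a
    0<q₁ = *-positive 0<θ 0<fa
    0<q₁l = *-positive 0<q₁ 0<l
    0<q₂ = *-positive 0<θ 0<q₁l
    0<w = *-positive 0<θ 0<v
    4-positive : Positive (nat 4)
    4-positive = f , 0<f , f<4
    log-N-unbounded = log-unbounded {nat N} (nat-unbounded N)
    q₁-lower : lower (nat 4 * power) q₁
    q₁-lower = *-lower {nat 4} {power} (nat-unbounded 4) power-unbounded
      (ℚ.<⇒≤ 0<f) f<4 (ℚ.<⇒≤ 0<a) a<power (θ*< 0<fa)
    4power-unbounded : Unbounded (nat 4 * power)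
    4power-unbounded = *-unbounded {nat 4} {power}
      4-positive (nat-unbounded 4) (a , 0<a , a<power) power-unbounded
    q₂-lower : lower (nat 4 * power * log (nat N)) q₂
    q₂-lower = *-lower {nat 4 * power} {log (nat N)} 4power-unbounded log-N-unbounded
      (ℚ.<⇒≤ 0<q₁) q₁-lower (ℚ.<⇒≤ 0<l) l<logN (θ*< 0<q₁l)
    numerator-unbounded : Unbounded (nat 4 * power * log (nat N))
    numerator-unbounded = *-unbounded {nat 4 * power} {log (nat N)}
      (q₁ , 0<q₁ , q₁-lower) 4power-unbounded (l , 0<l , l<logN) log-N-unbounded
    w-lower : lower (log y ⁻¹) w
    w-lower = u , 0<u , logy<u , subst₂ ℚ._<_ (sym (ℚ.*-assoc θ v u)) vu≡1
      (θ*< (*-positive 0<v 0<u))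
    q₃-lower : lower (nat 4 * power * log (nat N) / log y) q₃
    q₃-lower = *-lower {nat 4 * power * log (nat N)} {log y ⁻¹}
      numerator-unbounded (⁻¹-unbounded {log y} log-y-positive)
      (ℚ.<⇒≤ 0<q₂) q₂-lower (ℚ.<⇒≤ 0<w) w-lower (θ*< (*-positive 0<q₂ 0<w))

  -- The left side of `count` is positive: the power exceeds `θ`, log N exceeds 1, and log y < N
  -- because y ≤ N < 1 + N ≤ exp N.
  K-nonZero : y ≤ nat N → 0 ℕ.< K
  K-nonZero y≤N = ι-cancel-< {0} {K} (ℚ.<-trans
    (*-positive (from-yes (0ℚ ℚ.<? θ ℚ.* θ ℚ.* θ ℚ.* θ ℚ.* θ ℚ.* ι 4))
      (*-positive (*-positive 0<θ 0<1) 0<v))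
    (counting-bound {θ} {1ℚ} {ι N} {inv N} 0<θ
      (1≤^-lower {x} {nat 2 * y} Rx x<1 2y-lower 2y-unbounded (from-yes (θ ℚ.<? 1ℚ)))
      0<1 (1<log {nat N} (ι-mono-< {4} {N} 4<N))
      0<N (log-upper-of-≤ {y} {ι N} {ι N} Ry y≤N (0≤ι N) 2 (q<expSum-ι N))
      0<v (trans (ℚ.*-comm (inv N) (ι N)) (ι-inv N))))
    where
    instance N≢0 : ℕ.NonZero N
             N≢0 = ℕ.>-nonZero (ℕ.≤-<-trans ℕ.z≤n 4<N)
    0<1 = from-yes (0ℚ ℚ.<? 1ℚ)
    0<N : 0ℚ ℚ.< ι N
    0<N = ι-mono-< {0} {N} (ℕ.≤-<-trans ℕ.z≤n 4<N)
    0<v = inv-positive N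

  -- An integer z with e ^ z ≤ p ^ 2K < e ^ (z + 1) gives rational approximations
  -- (z + 1) / 2K > log y and (z + 1) / 7D < log N.  It exists only classically,
  -- which suffices for a negation: absurd and ¬Above rule it out by induction on z.
  too-many : ∀ {p D} .{{_ : ℕ.NonZero p}} .{{_ : ℕ.NonZero D}} .{{_ : ℕ.NonZero K}} →
    y ≤ nat p → lower power (θ ℚ.* ι D) →
    ¬ p ℕ.^ (2 ℕ.* K) ℕ.* 3 ℕ.≤ ℕ.pred N ℕ.^ (7 ℕ.* D)
  too-many {p} {D} y≤p θD<power Z*3≤ = ¬Above Z (2 , q<expSum-ι Z)
    where
    open ℚ.≤-Reasoning
    Z = p ℕ.^ (2 ℕ.* K)
    instance
      Z≢0 : ℕ.NonZero Z
      Z≢0 = ℕ.m^n≢0 p (2 ℕ.* K)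
      7D≢0 : ℕ.NonZero (7 ℕ.* D)
      7D≢0 = ℕ.m*n≢0 7 D
      2K≢0 : ℕ.NonZero (2 ℕ.* K)
      2K≢0 = ℕ.m*n≢0 2 K
    Above : ℕ → Set
    Above z = ∃[ n ] ι Z ℚ.< expSum (ι z) n
    module _ (z : ℕ) (E≤Z : ∀ n → expSum (ι z) n ℚ.≤ ι Z) (n : ℕ) (Z<E : ι Z ℚ.< expSum (ι (suc z)) n) where
      s = ι (suc z)
      0<s : 0ℚ ℚ.< s
      0<s = ι-mono-< {0} {suc z} (ℕ.s≤s ℕ.z≤n)
      l = s ℚ.* inv (7 ℕ.* D)
      u = s ℚ.* inv (2 ℕ.* K)
      v = ι (2 ℕ.* K) ℚ.* inv (suc z)
      0<l = *-positive 0<s (inv-positive (7 ℕ.* D))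
      0<u = *-positive 0<s (inv-positive (2 ℕ.* K))
      0<v = *-positive (ι-mono-< {0} {2 ℕ.* K} (ℕ.>-nonZero⁻¹ (2 ℕ.* K))) (inv-positive (suc z))
      unscale : ∀ k .{{_ : ℕ.NonZero k}} → ι k ℚ.* (s ℚ.* inv k) ≡ s
      unscale k = trans (lem (ι k) s (inv k)) (trans (cong (s ℚ.*_) (ι-inv k)) (ℚ.*-identityʳ s))
        where
        lem : ∀ a b c → a ℚ.* (b ℚ.* c) ≡ b ℚ.* (a ℚ.* c)
        lem = solve-∀ ring
      -- exp (z + 1) ≤ 3 exp z ≤ 3 Z: the factor 3 in `Z*3≤` is spent here, before the root of order
      -- 7D is taken.
      El≤ : ∀ m → expSum l m ℚ.≤ ι (ℕ.pred N)
      El≤ m = ^-cancel-≤ (7 ℕ.* D) (0≤ι (ℕ.pred N)) (begin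
        expSum l m ^ℚ (7 ℕ.* D)              ≤⟨ expSum-*-≥ (ℚ.<⇒≤ 0<l) (7 ℕ.* D) m ⟩
        expSum (ι (7 ℕ.* D) ℚ.* l) m′        ≡⟨ cong (λ w → expSum w m′) (unscale (7 ℕ.* D)) ⟩
        expSum s m′                          ≡⟨ cong (λ w → expSum w m′) (trans (ι-suc z) (ℚ.+-comm 1ℚ (ι z))) ⟩
        expSum (ι z ℚ.+ 1ℚ) m′               ≤⟨ expSum-+-≤ (0≤ι z) 0≤1 m′ ⟩
        expSum (ι z) m′ ℚ.* expSum 1ℚ m′     ≤⟨ *-mono (expSum-nonneg (0≤ι z) m′) (E≤Z m′)
                                                  (expSum-nonneg 0≤1 m′) (expSum-1≤3 m′) ⟩
        ι Z ℚ.* ι 3                          ≡⟨ ι-homo-* Z 3 ⟨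
        ι (Z ℕ.* 3)                          ≤⟨ ι-mono-≤ {Z ℕ.* 3} {ℕ.pred N ℕ.^ (7 ℕ.* D)} Z*3≤ ⟩
        ι (ℕ.pred N ℕ.^ (7 ℕ.* D))           ≡⟨ ι-homo-^ (ℕ.pred N) (7 ℕ.* D) ⟩
        ι (ℕ.pred N) ^ℚ (7 ℕ.* D)            ∎)
        where m′ = suc (7 ℕ.* D ℕ.* m)
      p<Eu : ι p ℚ.< expSum u n
      p<Eu = ℚ.≰⇒> λ Eu≤p → ℚ.<-irrefl refl (begin-strict
        ι Z                          <⟨ Z<E ⟩
        expSum s n                   ≡⟨ cong (λ w → expSum w n) (unscale (2 ℕ.* K)) ⟨
        expSum (ι (2 ℕ.* K) ℚ.* u) n ≤⟨ expSum-*-≤ (ℚ.<⇒≤ 0<u) (2 ℕ.* K) n ⟩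
        expSum u n ^ℚ (2 ℕ.* K)      ≤⟨ ^-mono (2 ℕ.* K) (expSum-nonneg (ℚ.<⇒≤ 0<u) n) Eu≤p ⟩
        ι p ^ℚ (2 ℕ.* K)             ≡⟨ ι-homo-^ p (2 ℕ.* K) ⟨
        ι Z                          ∎)
      vu≡1 : v ℚ.* u ≡ 1ℚ
      vu≡1 = trans (lem (ι (2 ℕ.* K)) (inv (suc z)) s (inv (2 ℕ.* K)))
        (cong₂ ℚ._*_ (ι-inv (2 ℕ.* K)) (ι-inv (suc z)))
        where
        lem : ∀ a b c d → (a ℚ.* b) ℚ.* (c ℚ.* d) ≡ (a ℚ.* d) ℚ.* (c ℚ.* b)
        lem = solve-∀ ring
      Θ = θ ℚ.* θ ℚ.* θ ℚ.* θ ℚ.* θ ℚ.* ι 4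
      7Dlv : ι 7 ℚ.* (ι D ℚ.* l ℚ.* v) ≡ ι 2 ℚ.* ι K
      7Dlv = begin-equality
        ι 7 ℚ.* (ι D ℚ.* l ℚ.* v)      ≡⟨ lem (ι 7) (ι D) l v ⟩
        ((ι 7 ℚ.* ι D) ℚ.* l) ℚ.* v    ≡⟨ cong (λ w → w ℚ.* l ℚ.* v) (ι-homo-* 7 D) ⟨
        (ι (7 ℕ.* D) ℚ.* l) ℚ.* v      ≡⟨ cong (ℚ._* v) (unscale (7 ℕ.* D)) ⟩
        s ℚ.* v                        ≡⟨ lem′ s (ι (2 ℕ.* K)) (inv (suc z)) ⟩
        ι (2 ℕ.* K) ℚ.* (s ℚ.* inv (suc z)) ≡⟨ cong (ι (2 ℕ.* K) ℚ.*_) (ι-inv (suc z)) ⟩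
        ι (2 ℕ.* K) ℚ.* 1ℚ             ≡⟨ ℚ.*-identityʳ (ι (2 ℕ.* K)) ⟩
        ι (2 ℕ.* K)                    ≡⟨ ι-homo-* 2 K ⟩
        ι 2 ℚ.* ι K                    ∎
        where
        lem : ∀ a b c d → a ℚ.* (b ℚ.* c ℚ.* d) ≡ ((a ℚ.* b) ℚ.* c) ℚ.* d
        lem = solve-∀ ring
        lem′ : ∀ a b c → a ℚ.* (b ℚ.* c) ≡ b ℚ.* (a ℚ.* c)
        lem′ = solve-∀ ring
      -- As 7 D l v = 2 K, seven times the counting bound reads 8 θ ^ 6 K < 7 K, contrary to 8 θ ^ 6
      -- ≥ 7.
      absurd : ⊥
      absurd = ℚ.<-irrefl refl (begin-strict
        ι 7 ℚ.* (Θ ℚ.* ((θ ℚ.* ι D) ℚ.* l ℚ.* v))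
          <⟨ *-monoʳ-< (from-yes (0ℚ ℚ.<? ι 7))
               (counting-bound (*-positive 0<θ 0<D) θD<power
                 0<l (log-nat-lower {l} {ℕ.pred N} {N} El≤ pred<)
                 0<u (log-upper-of-≤ {y} {ι p} {u} Ry y≤p (ℚ.<⇒≤ 0<u) n p<Eu) 0<v vu≡1) ⟩
        ι 7 ℚ.* ι K
          ≤⟨ *-monoˡ (0≤ι K) (from-yes (ι 7 ℚ.≤? (Θ ℚ.* θ) ℚ.* ι 2)) ⟩
        (Θ ℚ.* θ) ℚ.* ι 2 ℚ.* ι K
          ≡⟨ ℚ.*-assoc (Θ ℚ.* θ) (ι 2) (ι K) ⟩
        (Θ ℚ.* θ) ℚ.* (ι 2 ℚ.* ι K)
          ≡⟨ cong ((Θ ℚ.* θ) ℚ.*_) 7Dlv ⟨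
        (Θ ℚ.* θ) ℚ.* (ι 7 ℚ.* (ι D ℚ.* l ℚ.* v))
          ≡⟨ lem Θ θ (ι 7) (ι D) l v ⟩
        ι 7 ℚ.* (Θ ℚ.* ((θ ℚ.* ι D) ℚ.* l ℚ.* v)) ∎)
        where
        lem : ∀ Θ θ s d l v → (Θ ℚ.* θ) ℚ.* (s ℚ.* (d ℚ.* l ℚ.* v)) ≡ s ℚ.* (Θ ℚ.* ((θ ℚ.* d) ℚ.* l ℚ.* v))
        lem = solve-∀ ring
        0<D : 0ℚ ℚ.< ι D
        0<D = ι-mono-< {0} {D} (ℕ.>-nonZero⁻¹ D)
        pred< : ℕ.pred N ℕ.< N
        pred< = ℕ.≤-reflexive (ℕ.suc-pred N {{ℕ.>-nonZero (ℕ.≤-<-trans ℕ.z≤n 4<N)}})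
    ¬Above : ∀ z → ¬ Above z
    ¬Above zero (zero , Z<E) = ℚ.<-irrefl refl (ℚ.<-≤-trans Z<E (0≤ι Z))
    ¬Above zero (suc n , Z<E) = ℚ.<-irrefl refl (ℚ.<-≤-trans (subst (ι Z ℚ.<_) (expSum-0 n) Z<E)
      (ι-mono-≤ {1} {Z} (ℕ.>-nonZero⁻¹ Z)))
    -- The order on rationals is decidable, so the induction hypothesis gives the bound Z for every
    -- partial sum at z.
    ¬Above (suc z) (n , Z<E) = absurd z (λ m → ℚ.≮⇒≥ λ Z<E → ¬Above z (m , Z<E)) n Z<E

-- Extremal elements and the sizes of the intervals

minimum : ∀ P → 0 <ℕ length P → ∃[ p ] IsMinimum p P
minimum (p ∷ [])     _ = p , here refl , ℕ.≤-refl ∷ []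
minimum (p ∷ q ∷ P) _ with minimum (q ∷ P) (ℕ.s≤s ℕ.z≤n)
... | m , m∈ , m≤ with ℕ.≤-total p m
...   | inj₁ p≤m = p , here refl , ℕ.≤-refl ∷ All.map (ℕ.≤-trans p≤m) m≤
...   | inj₂ m≤p = m , there m∈ , m≤p ∷ m≤

-- Starting from 1 keeps D positive, which 2 (2D + 1) ≤ 6D requires. Otherwise the maximum is
-- attained, so that the size hypothesis at a single prime bounds D.
maximum : ∀ (f : ℕ → ℕ) P →
  ∃[ D ] (1 ℕ.≤ D × (∀ {p} → p ∈ P → f p ℕ.≤ suc D) × (D ≡ 1 ⊎ ∃[ p ] (p ∈ P × f p ≡ suc D)))
maximum f [] = 1 , ℕ.≤-refl , (λ ()) , inj₁ refl
maximum f (p ∷ P) with maximum f P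
... | D , 1≤D , f≤ , attained with f p ℕ.≤? suc D
...   | yes fp≤ = D , 1≤D , (λ { (here refl) → fp≤ ; (there p∈P) → f≤ p∈P }) , lift attained
  where
  lift : D ≡ 1 ⊎ ∃[ q ] (q ∈ P × f q ≡ suc D) → D ≡ 1 ⊎ ∃[ q ] (q ∈ p ∷ P × f q ≡ suc D)
  lift (inj₁ eq)            = inj₁ eq
  lift (inj₂ (q , q∈P , e)) = inj₂ (q , there q∈P , e)
...   | no  fp≰ = ℕ.pred (f p) , ℕ.≤-trans 1≤D (ℕ.<⇒≤ D<) ,
        (λ { (here refl) → ℕ.≤-reflexive (sym eq)
           ; (there p∈P) → ℕ.≤-trans (f≤ p∈P) (ℕ.m≤n⇒m≤1+n D<) }) ,
        inj₂ (p , here refl , sym eq)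
  where
  eq : suc (ℕ.pred (f p)) ≡ f p
  eq = ℕ.suc-pred (f p) {{ℕ.>-nonZero (ℕ.≤-trans (ℕ.s≤s ℕ.z≤n) (ℕ.≰⇒> fp≰))}}
  D< : D <ℕ ℕ.pred (f p)
  D< = ℕ.s≤s⁻¹ (subst (suc (suc D) ℕ.≤_) (sym eq) (ℕ.≰⇒> fp≰))

nat-mono : ∀ {m n} → m ℕ.≤ n → nat m ≤ nat n
nat-mono {m} {n} m≤n q q<m = ℚ.<-≤-trans q<m (ι-mono-≤ {m} {n} m≤n)

≤-nat⇒< : ∀ {y n C} → y ≤ nat n → lower y (ι C) → C <ℕ n
≤-nat⇒< {n = n} {C} y≤n C<y = ι-cancel-< {C} {n} (y≤n (ι C) C<y)

-- Taken with n = N this bounds the primes, and with n in P it compares two elements of P up to a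
-- factor 2.
doubling : ∀ {y m n} → Positive y → y ≤ nat n → nat m ≤ nat 2 * y → m ℕ.≤ 2 ℕ.* n
doubling {y} {m} {n} y-positive y≤n m≤2y = ℕ.≮⇒≥ λ 2n<m →
  let a , c , 0<a , a<2 , 0<c , c<y , 2n<ac =
        *-lower⁻ {nat 2} {y} (1ℚ , from-yes (0ℚ ℚ.<? 1ℚ) , from-yes (1ℚ ℚ.<? ι 2)) y-positive
          (λ b 2<b → ℚ.<⇒≤ (ℚ.<-trans (from-yes (0ℚ ℚ.<? ι 2)) 2<b))
          (m≤2y (ι (2 ℕ.* n)) (ι-mono-< {2 ℕ.* n} {m} 2n<m))
  in ℚ.<-irrefl refl (begin-strict
    ι (2 ℕ.* n)    <⟨ 2n<ac ⟩
    a ℚ.* c        ≤⟨ *-mono (ℚ.<⇒≤ 0<a) (ℚ.<⇒≤ a<2) (ℚ.<⇒≤ 0<c) (ℚ.<⇒≤ (y≤n c c<y)) ⟩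
    ι 2 ℚ.* ι n    ≡⟨ ι-homo-* 2 n ⟨
    ι (2 ℕ.* n)    ∎)
  where open ℚ.≤-Reasoning

-- At D + θ the hypothesis yields a splitting a + b with b < 1, so a > D + θ - 1. This is at least θ
-- D, because (1 - θ) (D - 1) ≥ 0.
exponent-lower : ∀ {x D} .{{_ : NonZero D}} → nat (suc D) ≤ exp x + nat 1 → lower (exp x) (θ ℚ.* ι D)
exponent-lower {x} {D} 1+D≤ with 1+D≤ (ι D ℚ.+ θ) D+θ<1+D
  where
  D+θ<1+D : ι D ℚ.+ θ ℚ.< ι (suc D)
  D+θ<1+D = subst (ι D ℚ.+ θ ℚ.<_) (trans (ℚ.+-comm (ι D) 1ℚ) (sym (ι-suc D)))
    (ℚ.+-monoʳ-< (ι D) (from-yes (θ ℚ.<? 1ℚ)))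
... | a , b , (t , t<x , a<exp) , b<1 , eq = t , t<x , expℚ-lower-closed {t = t} θD≤a a<exp
  where
  open ℚ.≤-Reasoning
  lem₁ : ∀ a b → a ℚ.+ b ℚ.- b ≡ a
  lem₁ = solve-∀ ring
  lem₂ : ∀ θ d → θ ℚ.* d ≡ (d ℚ.+ θ) ℚ.- ((1ℚ ℚ.- θ) ℚ.* d ℚ.+ θ)
  lem₂ = solve-∀ ring
  lem₃ : ∀ θ → (1ℚ ℚ.- θ) ℚ.* 1ℚ ℚ.+ θ ≡ 1ℚ
  lem₃ = solve-∀ ring
  b≤ : b ℚ.≤ (1ℚ ℚ.- θ) ℚ.* ι D ℚ.+ θ
  b≤ = begin
    b                               ≤⟨ ℚ.<⇒≤ b<1 ⟩
    1ℚ                              ≡⟨ lem₃ θ ⟨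
    (1ℚ ℚ.- θ) ℚ.* 1ℚ ℚ.+ θ         ≤⟨ ℚ.+-monoˡ-≤ θ (*-monoʳ (from-yes (0ℚ ℚ.≤? 1ℚ ℚ.- θ))
                                         (ι-mono-≤ {1} {D} (ℕ.>-nonZero⁻¹ D))) ⟩
    (1ℚ ℚ.- θ) ℚ.* ι D ℚ.+ θ        ∎
  θD≤a : θ ℚ.* ι D ℚ.≤ a
  θD≤a = begin
    θ ℚ.* ι D                                          ≡⟨ lem₂ θ (ι D) ⟩
    (ι D ℚ.+ θ) ℚ.- ((1ℚ ℚ.- θ) ℚ.* ι D ℚ.+ θ)         ≤⟨ ℚ.+-monoʳ-≤ (ι D ℚ.+ θ) (ℚ.neg-antimono-≤ b≤) ⟩
    (ι D ℚ.+ θ) ℚ.- b                                  ≡⟨ cong (ℚ._- b) eq ⟩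
    a ℚ.+ b ℚ.- b                                      ≡⟨ lem₁ a b ⟩
    a                                                  ∎

-- If p ≤ 8D, then p ≤ 16 θ D with (θ D) ^ (k + 1) ≤ p ^ k. Raising to the power k + 1 and
-- cancelling p ^ k leaves p ≤ 16 ^ (k + 1). So `big` is the form in which p ^ ε is large.
size-bound : ∀ {x} → IsReal x → x < nat 1 → ∀ {e} → lower x e → ∀ k → 1ℚ ℚ.≤ ι (suc k) ℚ.* e →
  ∀ {p D} → 16 ℕ.^ suc k <ℕ p → lower (nat p ^ (nat 1 - x)) (θ ℚ.* ι D) → 8 ℕ.* D <ℕ p
size-bound {x} R x<1 {e} e<x k 1≤ke {p} {D} big θD< = ℕ.≰⇒> λ p≤8D →
  let open ℚ.≤-Reasoning
      ιp≤ : ι p ℚ.≤ ι 16 ℚ.* (θ ℚ.* ι D)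
      ιp≤ = begin
        ι p                       ≤⟨ ι-mono-≤ {p} {8 ℕ.* D} p≤8D ⟩
        ι (8 ℕ.* D)               ≡⟨ ι-homo-* 8 D ⟩
        ι 8 ℚ.* ι D               ≤⟨ *-monoˡ (0≤ι D) (from-yes (ι 8 ℚ.≤? ι 16 ℚ.* θ)) ⟩
        (ι 16 ℚ.* θ) ℚ.* ι D      ≡⟨ ℚ.*-assoc (ι 16) θ (ι D) ⟩
        ι 16 ℚ.* (θ ℚ.* ι D)      ∎
      -- `^-lower-bound` asks for a value of at least 1; 16 ≤ p ≤ 16 θ D provides it.
      1≤θD : 1ℚ ℚ.≤ θ ℚ.* ι D
      1≤θD = ℚ.*-cancelˡ-≤-pos (ι 16) (ℚ.≤-trans
        (ι-mono-≤ {16} {p} (ℕ.<⇒≤ 16<p)) ιp≤)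
      p^≤ : ι (p ℕ.^ suc k) ℚ.≤ ι (16 ℕ.^ suc k ℕ.* p ℕ.^ k)
      p^≤ = begin
        ι (p ℕ.^ suc k)
          ≡⟨ ι-homo-^ p (suc k) ⟩
        ι p ^ℚ suc k
          ≤⟨ ^-mono (suc k) (0≤ι p) ιp≤ ⟩
        (ι 16 ℚ.* (θ ℚ.* ι D)) ^ℚ suc k
          ≡⟨ ^-distrib-* (ι 16) (θ ℚ.* ι D) (suc k) ⟩
        ι 16 ^ℚ suc k ℚ.* (θ ℚ.* ι D) ^ℚ suc k
          ≤⟨ *-monoʳ (^-nonneg (suc k) (0≤ι 16))
               (^-lower-bound {x} R x<1 e<x k 1≤ke p 4<p 1≤θD θD<) ⟩
        ι 16 ^ℚ suc k ℚ.* ι (p ℕ.^ k)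
          ≡⟨ cong (ℚ._* ι (p ℕ.^ k)) (ι-homo-^ 16 (suc k)) ⟨
        ι (16 ℕ.^ suc k) ℚ.* ι (p ℕ.^ k)
          ≡⟨ ι-homo-* (16 ℕ.^ suc k) (p ℕ.^ k) ⟨
        ι (16 ℕ.^ suc k ℕ.* p ℕ.^ k) ∎
  in ℕ.<-irrefl refl (ℕ.<-≤-trans big
       (ℕ.*-cancelʳ-≤ p (16 ℕ.^ suc k) (p ℕ.^ k) {{ℕ.m^n≢0 p k {{p≢0}}}}
         (ι-cancel-≤ {p ℕ.^ suc k} {16 ℕ.^ suc k ℕ.* p ℕ.^ k} p^≤)))
  where
  p≢0 : NonZero p
  p≢0 = ℕ.>-nonZero (ℕ.≤-<-trans ℕ.z≤n big)
  16<p : 16 <ℕ p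
  16<p = ℕ.≤-<-trans (ℕ.^-monoʳ-≤ 16 {1} {suc k} (ℕ.s≤s ℕ.z≤n)) big
  4<p : 4 <ℕ p
  4<p = ℕ.<-trans (ℕ.s≤s (ℕ.s≤s (ℕ.s≤s (ℕ.s≤s (ℕ.s≤s ℕ.z≤n))))) 16<p

-- The sieved set inside the natural numbers

module _ (N : ℕ) (P : List ℕ) (I : (p : ℕ) → Subset p) where

  SievedNat : ℕ → Set
  SievedNat n = n ℕ.≤ N × (∀ p .{{_ : NonZero p}} → p ∈ P → residue (+ n) p ∈ₛ I p)

  sievedNat? : ∀ n → Dec (SievedNat n)
  sievedNat? n with n ℕ.≤? N | All.all? in-class? P
    where
    in-class? : ∀ p → Dec (∀ .{{_ : NonZero p}} → residue (+ n) p ∈ₛ I p)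
    -- `NonZero 0` has no instance, so the condition at 0 holds vacuously.
    in-class? zero    = yes λ { {{()}} }
    in-class? (suc p) = map′ (λ r∈I → r∈I) (λ r∈I → r∈I) (residue (+ n) (suc p) ∈? I (suc p))
  ... | no  n≰N | _       = no (n≰N ∘ proj₁)
  ... | yes n≤N | yes all = yes (n≤N , λ p p∈P → All.lookup all p∈P)
  ... | yes n≤N | no ¬all = no λ S → ¬all (All.tabulate λ {p} p∈P → proj₂ S p p∈P)

  sieved-interval :
    (∀ a g → SievedNat a → SievedNat (a ℕ.+ g) → ∀ k → k ℕ.≤ g → SievedNat (a ℕ.+ k)) →
    IsInterval (Sieved N P I) 0 ⊎
    ∃[ a ] ∃[ g ] (SievedNat a × SievedNat (a ℕ.+ g) × IsInterval (Sieved N P I) (suc g))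
  sieved-interval convex with extremes SievedNat sievedNat? (suc N)
  ... | inj₁ none = inj₁ (+ 0 , λ n → mk⇔ (⊥-elim ∘ empty n)
          λ (0≤n , n<0) → ⊥-elim (ℤ.<-irrefl refl (ℤ.≤-<-trans 0≤n n<0)))
    where
    empty : ∀ n → ¬ Sieved N P I n
    empty (+ n) (_ , n≤N , S) = none n (ℕ.s≤s (ℤ.drop‿+≤+ n≤N)) (ℤ.drop‿+≤+ n≤N , S)
    empty -[1+ n ] (() , _)
  ... | inj₂ (a , g , Sa , Sb , _ , bounds) =
    inj₂ (a , g , Sa , Sb , + a , λ n → mk⇔ (to n) (from n))
    where
    to : ∀ n → Sieved N P I n → + a ℤ.≤ n × n ℤ.< + a ℤ.+ + suc g
    to (+ n) (_ , n≤N , S) with bounds n (ℕ.s≤s (ℤ.drop‿+≤+ n≤N)) (ℤ.drop‿+≤+ n≤N , S)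
    ... | a≤n , n≤b = ℤ.+≤+ a≤n , ℤ.+<+ (subst (n <ℕ_) (sym (ℕ.+-suc a g)) (ℕ.s≤s n≤b))
    to -[1+ n ] (() , _)
    from : ∀ n → + a ℤ.≤ n × n ℤ.< + a ℤ.+ + suc g → Sieved N P I n
    from (+ n) (ℤ.+≤+ a≤n , ℤ.+<+ n<) =
      let n≤N , S = subst SievedNat (ℕ.m+[n∸m]≡n a≤n) (convex a g Sa Sb (n ℕ.∸ a) n∸a≤g)
      in ℤ.+≤+ ℕ.z≤n , ℤ.+≤+ n≤N , S
      where
      n∸a≤g : n ℕ.∸ a ℕ.≤ g
      n∸a≤g = ℕ.m≤n+o⇒m∸n≤o n a (ℕ.s≤s⁻¹ (subst (n <ℕ_) (ℕ.+-suc a g) n<))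
    from -[1+ n ] (() , _)

-- The sieve argument

module Sieve
  {ε : Cut} (Rε : IsReal ε) (ε<1 : ε < nat 1)
  {e : ℚ} (e<ε : lower ε e) (k : ℕ) (1≤ke : 1ℚ ℚ.≤ ι (suc k) ℚ.* e)
  {N : ℕ} (12288<N : 12288 <ℕ N)
  {y : Cut} (Ry : IsReal y) (y≤N : y ≤ nat N)
  (4<y : lower y (ι 4)) (16^<y : lower y (ι (16 ℕ.^ suc k)))
  {P : List ℕ} (uP : Unique P) (primes : All Prime P)
  (range : All (λ p → y ≤ nat p × nat p ≤ nat 2 * y) P)
  (count : nat 4 * (nat 2 * y) ^ (nat 1 - ε) * log (nat N) / log y ≤ nat (length P))
  {I : (p : ℕ) → Subset p}
  (intervals : ∀ p .{{_ : NonZero p}} → p ∈ P →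
    IsIntervalMod p (I p) × nat ∣ I p ∣ ≤ nat p ^ (nat 1 - ε) + nat 1)
  where

  y-positive : Positive y
  y-positive = ι 4 , from-yes (0ℚ ℚ.<? ι 4) , 4<y

  open Counting {ε} Rε ε<1 {y} Ry 4<y {N} {length P} (≤-nat⇒< {y} {N} {4} y≤N 4<y) count

  p₀-minimum : ∃[ p ] IsMinimum p P
  p₀-minimum = minimum P (K-nonZero y≤N)

  p₀ = proj₁ p₀-minimum
  p₀∈P = proj₁ (proj₂ p₀-minimum)
  p₀≤P = proj₂ (proj₂ p₀-minimum)

  module _ {p} (p∈P : p ∈ P) where
    p≢0 : NonZero p
    p≢0 = prime⇒nonZero (All.lookup primes p∈P)

    y≤p = proj₁ (All.lookup range p∈P)
    p≤2y = proj₂ (All.lookup range p∈P)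

    4<p : 4 <ℕ p
    4<p = ≤-nat⇒< {y} {p} {4} y≤p 4<y

    16^<p : 16 ℕ.^ suc k <ℕ p
    16^<p = ≤-nat⇒< {y} {p} {16 ℕ.^ suc k} y≤p 16^<y

    interval : IsIntervalMod p {{p≢0}} (I p)
    interval = proj₁ (intervals p {{p≢0}} p∈P)

    size : nat ∣ I p ∣ ≤ nat p ^ (nat 1 - ε) + nat 1
    size = proj₂ (intervals p {{p≢0}} p∈P)

  D-maximum = maximum (λ p → ∣ I p ∣) P
  D = proj₁ D-maximum
  1≤D = proj₁ (proj₂ D-maximum)
  ∣I∣≤1+D = proj₁ (proj₂ (proj₂ D-maximum))
  instance D≢0 : NonZero D
           D≢0 = ℕ.>-nonZero 1≤D

  -- Either D is the default 1, and both bounds follow from y > 4, or some `q` in P has an interval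
  -- of D + 1 residues. Then θ D < q ^ (1 - ε) ≤ (2y) ^ (1 - ε), and 8 D < q ≤ 2 p for every p in P:
  -- passing from q to p turns the 8 into 4.
  θD-bounds : lower power (θ ℚ.* ι D) × (∀ {p} → p ∈ P → 4 ℕ.* D <ℕ p)
  θD-bounds with proj₂ (proj₂ (proj₂ D-maximum))
  ... | inj₁ D≡1 =
    subst (λ d → lower power (θ ℚ.* ι d)) (sym D≡1)
      (1≤^-lower {ε} {nat 2 * y} Rε ε<1 2y-lower 2y-unbounded (from-yes (θ ℚ.* ι 1 ℚ.<? 1ℚ))) ,
    λ p∈P → subst (λ d → 4 ℕ.* d <ℕ _) (sym D≡1) (4<p p∈P)
  ... | inj₂ (q , q∈P , ∣I∣≡1+D) =
    ^-mono-lower {ε} Rε ε<1 {nat q} {nat 2 * y} (p≤2y q∈P)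
      (y≤p q∈P (ι 4) 4<y) 2y-unbounded θD<q ,
    λ {p} p∈P → ℕ.*-cancelˡ-< 2 (4 ℕ.* D) p (subst (_<ℕ 2 ℕ.* p) (ℕ.*-assoc 2 4 D)
      (ℕ.<-≤-trans (size-bound {ε} Rε ε<1 e<ε k 1≤ke {q} {D} (16^<p q∈P) θD<q)
        (doubling {y} {q} {p} y-positive (y≤p p∈P) (p≤2y q∈P))))
    where
    θD<q : lower (nat q ^ (nat 1 - ε)) (θ ℚ.* ι D)
    θD<q = exponent-lower {(nat 1 - ε) * log (nat q)} {D}
      (subst (λ s → nat s ≤ nat q ^ (nat 1 - ε) + nat 1) ∣I∣≡1+D (size q∈P))

  4D<p : ∀ {p} → p ∈ P → 4 ℕ.* D <ℕ p
  4D<p = proj₂ θD-bounds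

  1+D+D≤p : ∀ {p} → p ∈ P → D ℕ.+ suc D ℕ.≤ p
  1+D+D≤p {p} p∈P = begin
    D ℕ.+ suc D       ≤⟨ ℕ.+-monoʳ-≤ D (ℕ.+-monoˡ-≤ D 1≤D) ⟩
    D ℕ.+ (D ℕ.+ D)   ≤⟨ ℕ.m≤m+n _ D ⟩
    D ℕ.+ (D ℕ.+ D) ℕ.+ D ≡⟨ lem D ⟩
    4 ℕ.* D           ≤⟨ ℕ.<⇒≤ (4D<p p∈P) ⟩
    p                 ∎
    where
    open ℕ.≤-Reasoning
    lem : ∀ D → D ℕ.+ (D ℕ.+ D) ℕ.+ D ≡ 4 ℕ.* D
    lem = ℕ-Solver.solve-∀

  ∣I∣<p : ∀ {p} → p ∈ P → ∣ I p ∣ <ℕ p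
  ∣I∣<p {p} p∈P = ℕ.≤-<-trans (∣I∣≤1+D p∈P)
    (ℕ.<-≤-trans (ℕ.m<n+m (suc D) 1≤D) (1+D+D≤p p∈P))

  D≤N : D ℕ.≤ N
  D≤N = ℕ.*-cancelˡ-≤ 2 (begin
    2 ℕ.* D  ≤⟨ ℕ.*-monoˡ-≤ D (ℕ.m≤n+m 2 2) ⟩
    4 ℕ.* D  ≤⟨ ℕ.<⇒≤ (4D<p p₀∈P) ⟩
    p₀       ≤⟨ doubling {y} {p₀} {N} y-positive y≤N (p≤2y p₀∈P) ⟩
    2 ℕ.* N  ∎)
    where open ℕ.≤-Reasoning

  S = SievedNat N P I

  gap≤D : ∀ a g → S a → S (a ℕ.+ g) → g ℕ.≤ D
  gap≤D a g (_ , Sa) (b≤N , Sb) = ℕ.≮⇒≥ λ D<g → large-gap D<g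
    where
    large-gap : ¬ D <ℕ g
    large-gap D<g = too-many {p₀} {D} {{p≢0 p₀∈P}} {{D≢0}} {{ℕ.>-nonZero (K-nonZero y≤N)}}
      (y≤p p₀∈P) (proj₁ θD-bounds)
      (power-comparison {p₀} {length P} {D} {N} 12288<N
        (primes-dividing-window uP primes p₀≤P {h} {suc (2 ℕ.* D)} {2 ℕ.* N}
          {{ℕ.>-nonZero (ℕ.m<n⇒0<n∸m D<g)}} h+j≤2N hit))
      where
      -- The window is g - D, ..., g + D. It starts above 0, and it ends at most at 2N since g and D
      -- are at most N.
      h = g ℕ.∸ D
      h+D≡g : h ℕ.+ D ≡ g
      h+D≡g = ℕ.m∸n+n≡m (ℕ.<⇒≤ D<g)
      h+j≤2N : ∀ {j} → j <ℕ suc (2 ℕ.* D) → h ℕ.+ j ℕ.≤ 2 ℕ.* N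
      h+j≤2N {j} j<1+2D = begin
        h ℕ.+ j            ≤⟨ ℕ.+-monoʳ-≤ h (ℕ.s≤s⁻¹ j<1+2D) ⟩
        h ℕ.+ 2 ℕ.* D      ≡⟨ lem h D ⟩
        h ℕ.+ D ℕ.+ D      ≡⟨ cong (ℕ._+ D) h+D≡g ⟩
        g ℕ.+ D            ≤⟨ ℕ.+-mono-≤ (ℕ.≤-trans (ℕ.m≤n+m g a) b≤N) D≤N ⟩
        N ℕ.+ N            ≡⟨ cong (N ℕ.+_) (ℕ.+-identityʳ N) ⟨
        2 ℕ.* N            ∎
        where
        open ℕ.≤-Reasoning
        lem : ∀ h D → h ℕ.+ 2 ℕ.* D ≡ h ℕ.+ D ℕ.+ D
        lem = ℕ-Solver.solve-∀
      hit : ∀ {p} → p ∈ P → ∃[ j ] (j <ℕ suc (2 ℕ.* D) × p ∣ℕ h ℕ.+ j)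
      hit {p} p∈P = gap-residue {p} {{p≢0 p∈P}} (∣I∣<p p∈P) (interval p∈P) (+ a) h {D}
        (∣I∣≤1+D p∈P) (Sa p {{p≢0 p∈P}} p∈P)
        (subst (λ g → residue (+ (a ℕ.+ g)) p {{p≢0 p∈P}} ∈ₛ I p) (sym h+D≡g) (Sb p {{p≢0 p∈P}} p∈P))

  local : ∀ a g → S a → S (a ℕ.+ g) → ∀ {p} .{{_ : NonZero p}} → p ∈ P →
    g <ℕ ∣ I p ∣ × (∀ k → k ℕ.≤ g → residue (+ (a ℕ.+ k)) p ∈ₛ I p)
  local a g Sa Sb {p} p∈P = short-gap {p} {{p≢0 p∈P}} (∣I∣<p p∈P) (interval p∈P) (+ a)
    (ℕ.≤-trans (ℕ.+-mono-≤ (gap≤D a g Sa Sb) (∣I∣≤1+D p∈P)) (1+D+D≤p p∈P))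
    (proj₂ Sa p {{p≢0 p∈P}} p∈P) (proj₂ Sb p {{p≢0 p∈P}} p∈P)

  convex : ∀ a g → S a → S (a ℕ.+ g) → ∀ k → k ℕ.≤ g → S (a ℕ.+ k)
  convex a g Sa Sb k k≤g = ℕ.≤-trans (ℕ.+-monoʳ-≤ a k≤g) (proj₁ Sb) ,
    λ p p∈P → proj₂ (local a g Sa Sb p∈P) k k≤g

  short : ∀ {ℓ} → ℓ ℕ.≤ ∣ I p₀ ∣ → nat ℓ ≤ nat p₀ ^ (nat 1 - ε) + nat 1
  short {ℓ} ℓ≤ q q<ℓ = size p₀∈P q (nat-mono {ℓ} {∣ I p₀ ∣} ℓ≤ q q<ℓ)

  conclusion : ∃[ p₀ ] (IsMinimum p₀ P ×
    Σ[ ℓ ∈ ℕ ] (IsInterval (Sieved N P I) ℓ × nat ℓ ≤ nat p₀ ^ (nat 1 - ε) + nat 1))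
  conclusion = p₀ , proj₂ p₀-minimum , length-of (sieved-interval N P I convex)
    where
    length-of : IsInterval (Sieved N P I) 0 ⊎
      ∃[ a ] ∃[ g ] (S a × S (a ℕ.+ g) × IsInterval (Sieved N P I) (suc g)) →
      Σ[ ℓ ∈ ℕ ] (IsInterval (Sieved N P I) ℓ × nat ℓ ≤ nat p₀ ^ (nat 1 - ε) + nat 1)
    length-of (inj₁ empty)                  = 0 , empty , short ℕ.z≤n
    length-of (inj₂ (a , g , Sa , Sb , int)) =
      suc g , int , short (proj₁ (local a g Sa Sb {{p≢0 p₀∈P}} p₀∈P))

-- Choice of the threshold on N

theorem1p3 : (ε : Cut) → IsReal ε → nat 0 < ε → ε < nat 1 →
    Σ[ N₀ ∈ ℕ ]
    ((N : ℕ) → N₀ <ℕ N →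
    (y : Cut) → IsReal y →
    (nat 16 * log (nat N)) ^ (nat 1 / ε) ≤ y → y ≤ nat N →
    (P : List ℕ) → Unique P → All Prime P →
    All (λ p → y ≤ nat p × nat p ≤ nat 2 * y) P →
    nat 4 * (nat 2 * y) ^ (nat 1 - ε) * log (nat N) / log y ≤ nat (length P) →
    (I : (p : ℕ) → Subset p) →
    (∀ p .{{_ : NonZero p}} → p ∈ P → IsIntervalMod p (I p) × nat ∣ I p ∣ ≤ nat p ^ (nat 1 - ε) + nat 1) →
    ∃[ p₀ ] (IsMinimum p₀ P ×
    Σ[ ℓ ∈ ℕ ] (IsInterval (Sieved N P I) ℓ × nat ℓ ≤ nat p₀ ^ (nat 1 - ε) + nat 1)))
theorem1p3 ε Rε 0<ε@(e , 0<e , e<ε) ε<1 = N₀ ,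
  λ N N₀<N y Ry base≤y y≤N P uP primes range count I intervals →
    let C<y = base≤y (ι C) (base-lower {ε} Rε 0<ε ε<1 C (ℕ.≤-<-trans (ℕ.m≤m+n tower 12288) N₀<N))
    in Sieve.conclusion {ε} Rε ε<1 {e} e<ε k 1≤ke {N} (ℕ.≤-<-trans (ℕ.m≤n+m 12288 tower) N₀<N)
         {y} Ry y≤N
         (IsReal.lower-closed Ry (ι-mono-< {4} {C} (ℕ.m<n+m 4 (ℕ.m^n>0 16 (suc k)))) C<y)
         (IsReal.lower-closed Ry (ι-mono-< {16 ℕ.^ suc k} {C} (ℕ.m<m+n (16 ℕ.^ suc k) (ℕ.s≤s ℕ.z≤n))) C<y)
         {P} uP primes range count {I} intervals
  where
  -- The integer k + 1 stands in for 1 / ε: it is at least 1 / e, and e < ε.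
  k = proj₁ (≤ι ((ℚ.1/ e) {{ℚ.>-nonZero 0<e}}))
  1≤ke : 1ℚ ℚ.≤ ι (suc k) ℚ.* e
  1≤ke = subst (ℚ._≤ ι (suc k) ℚ.* e) (ℚ.*-inverseˡ e {{ℚ.>-nonZero 0<e}})
    (*-monoˡ (ℚ.<⇒≤ 0<e) (ℚ.≤-trans (proj₂ (≤ι ((ℚ.1/ e) {{ℚ.>-nonZero 0<e}})))
      (ι-mono-≤ {k} {suc k} (ℕ.n≤1+n k))))
  -- One constant above both 16 ^ (k + 1), for `size-bound`, and 4, for the logarithms to exceed 1.
  C = 16 ℕ.^ suc k ℕ.+ 4
  -- The bound on N that `base-lower` requires for y > C; the summand 12288 below serves
  -- `power-comparison`.
  tower = 3 ℕ.^ (3 ℕ.^ (2 ℕ.* suc C) ℕ.+ 2)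
  N₀ = tower ℕ.+ 12288
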